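{- Let $\lambda=w_1w_2\cdots w_l$ be a word in the letters $N,E$ with $l\ge 1$, and let all notation ($P_k$, $B(P)$, $\Delta_k$, $a_{11}$, $a_{pq}$, $c([r,s])$, the sequences $\rho,\kappa$, quadruples and $\mathcal F(a,b)$) be as in the context. Then for every quadruple $(a,b)$, \[ c\big([\rho_{a+1},\kappa_b]\big)\,c\big([\rho_a,\kappa_{b+1}]\big)-c\big([\rho_{a+1},\kappa_{b+1}]\big)\,c\big([\rho_a,\kappa_b]\big)=\prod_{X\in\mathcal F(a,b)} X . \]
   Context: Lattice points: $P_1=(1,1)$ and, for $1\le k\le l$, $P_{k+1}=P_k+(0,1)$ if $w_k=N$ and $P_{k+1}=P_k+(1,0)$ if $w_k=E$. The $a_{ij}$ ($i,j\in\mathbb Z$) are independent indeterminates. For a lattice point $P=(x,y)$ let $B(P)$ be the $2\times 2$ matrix with first (top) row $(a_{x,y+1},a_{x+1,y+1})$ and second (bottom) row $(a_{x,y},a_{x+1,y})$, and set $\Delta_k=\det B(P_k)$ for $1\le k\le l+1$. Let $p=2+\#\{k:w_k=E\}$, $q=2+\#\{k:w_k=N\}$. For a $2\times2$ matrix $B$ (a "block"), $h_+(B),h_-(B)$ denote its top and bottom rows and $v_-(B),v_+(B)$ its left and right columns. A horizontal (vertical) domino is a $1\times 2$ ($2\times 1$) matrix. DRH matrices: given a sequence $X_0,X_1,\dots,X_n$ of dominoes and blocks, place them successively in the plane as arrays of unit cells, $X_t$ being placed either directly above $X_{t-1}$ (its bottom edge on the top edge of $X_{t-1}$, left edges aligned)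 or directly to the right of $X_{t-1}$ (its left edge on the right edge of $X_{t-1}$, bottom edges aligned); the directions alternate, the first being "above" if $X_0$ is a horizontal domino and "right" if $X_0$ is a vertical domino. The DRH matrix $X_0X_1\cdots X_n$ is the smallest rectangle containing all pieces, with the pieces' entries in their cells and $0$ in all other cells, with rows read top to bottom and columns left to right. Subskeleta: for $1\le r\le s\le l$, $[r,s]$ denotes the subword $w_r\cdots w_s$; its endpoints are the indices $r$ and $s+1$, and its bends are the indices $k$ with $r<k\le s$ and $w_{k-1}\ne w_k$. If $k_1<\dots<k_m$ are the bends of $[r,s]$, let $X_0=h_-(B(P_r))$ if $w_r=N$ and $X_0=v_-(B(P_r))$ if $w_r=E$, and $X_{m+1}=h_+(B(P_{s+1}))$ if $w_s=N$ and $X_{m+1}=v_+(B(P_{s+1}))$ if $w_s=E$; the standardization $\mathrm{Std}([r,s])$ is the DRH matrix $X_0B(P_{k_1})\cdots B(P_{k_m})X_{m+1}$, which is an $\eta\times\eta$ matrix, and $c([r,s])=(-1)^{(\eta-1)(\eta-2)/2}\det\mathrm{Std}([r,s])$. Let $e_1<\dots<e_\varepsilon$ be the indices $k$ with $w_k=E$ and $n_1<\dots<n_\nu$ those with $w_k=N$. Put $\rho=(\rho_1,\dots,\rho_l)=(e_\varepsilon,\dots,e_1,n_1,\dots,n_\nu)$ and $\kappa=(\kappa_1,\dots,\kappa_l)=(e_1,\dots,e_\varepsilon,n_\nu,\dots,n_1)$. A quadruple is a pair $(a,b)$ with $1\le a,b\le l-1$ such that $\rho_{a'}\le\kappa_{b'}$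 for all $a'\in\{a,a+1\}$, $b'\in\{b,b+1\}$. For a quadruple, let $\mu'=[\max(\rho_a,\rho_{a+1}),\min(\kappa_b,\kappa_{b+1})]$ and $\mu''=[\min(\rho_a,\rho_{a+1}),\max(\kappa_b,\kappa_{b+1})]$. Define the set $\mathcal F(a,b)$ to consist of: $\Delta_k$ for each bend $k$ of $\mu'$; $\Delta_k$ for each endpoint $k$ of $\mu''$; $\Delta_k$ for each endpoint $k$ of $\mu'$ that is a bend of $\mu''$; with the modifications that if $\kappa_b$ is an $E$-index and $\kappa_{b+1}$ an $N$-index then $\Delta_{l+1}$ is removed and $a_{pq}$ inserted, and if $\rho_a$ is an $E$-index and $\rho_{a+1}$ an $N$-index then $\Delta_1$ is removed and $a_{11}$ inserted. -}

module Defs where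

open import Algebra.Bundles using (CommutativeRing)
open import Data.Nat using (ℕ; zero; suc; _∸_; _≤_; _/_; _⊔_; _⊓_; _≡ᵇ_; _<ᵇ_)
import Data.Nat as Nat
open Nat using (_+_)
open import Data.Integer using (ℤ; +_)
open import Data.List using (List; []; _∷_; length; filterᵇ; map; reverse; _++_; foldr; upTo)
open import Data.Bool.ListAction using (any)
open import Data.Product using (_×_; _,_)
open import Data.Bool using (Bool; true; false; if_then_else_; not; _∧_)

-- Words in N, E  (all indices below are 1-based, as in the paper)

data Letter : Set where
  N E : Letter

isE : Letter → Bool
isE E = true
isE N = false

isN : Letter → Bool
isN N = true
isN E = false

_=L_ : Letter → Letter → Bool
N =L N = true
E =L E = true
N =L E = false
E =L N = false

-- w_k (1-based); out-of-range values are never used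
letter : List Letter → ℕ → Letter
letter [] k = N
letter (x ∷ xs) zero = N
letter (x ∷ xs) (suc zero) = x
letter (x ∷ xs) (suc (suc k)) = letter xs (suc k)

-- 1-based lookup in a list of naturals (default 0, never used)
at : List ℕ → ℕ → ℕ
at [] k = 0
at (x ∷ xs) zero = 0
at (x ∷ xs) (suc zero) = x
at (x ∷ xs) (suc (suc k)) = at xs (suc k)

interval : ℕ → ℕ → List ℕ
interval r s = map (λ t → r + t) (upTo (suc s ∸ r))

step : Letter → ℕ × ℕ → ℕ × ℕ
step N (x , y) = (x , suc y)
step E (x , y) = (suc x , y)

P : List Letter → ℕ → ℕ × ℕ
P w zero = (1 , 1)
P w (suc zero) = (1 , 1)
P w (suc (suc k)) = step (letter w (suc k)) (P w (suc k))

bends : List Letter → ℕ → ℕ → List ℕ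
bends w r s = filterᵇ (λ k → not (letter w (k ∸ 1) =L letter w k)) (interval (suc r) s)

endpoints : ℕ → ℕ → List ℕ
endpoints r s = r ∷ suc s ∷ []

elemᵇ : ℕ → List ℕ → Bool
elemᵇ k xs = any (k ≡ᵇ_) xs

eIdx : List Letter → List ℕ
eIdx w = filterᵇ (λ k → isE (letter w k)) (interval 1 (length w))

nIdx : List Letter → List ℕ
nIdx w = filterᵇ (λ k → isN (letter w k)) (interval 1 (length w))

ρ : List Letter → ℕ → ℕ
ρ w i = at (reverse (eIdx w) ++ nIdx w) i

κ : List Letter → ℕ → ℕ
κ w i = at (eIdx w ++ reverse (nIdx w)) i

pp : List Letter → ℕ
pp w = 2 + length (eIdx w)

qq : List Letter → ℕ
qq w = 2 + length (nIdx w)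

Quadruple : List Letter → ℕ → ℕ → Set
Quadruple w a b =
  (1 ≤ a) × (a ≤ length w ∸ 1) × (1 ≤ b) × (b ≤ length w ∸ 1) ×
  (ρ w a ≤ κ w b) × (ρ w a ≤ κ w (suc b)) ×
  (ρ w (suc a) ≤ κ w b) × (ρ w (suc a) ≤ κ w (suc b))

modR : List Letter → ℕ → Bool
modR w b = isE (letter w (κ w b)) ∧ isN (letter w (κ w (suc b)))

modL : List Letter → ℕ → Bool
modL w a = isE (letter w (ρ w a)) ∧ isN (letter w (ρ w (suc a)))

-- indices k such that Δ_k ∈ F(a,b)
Fidx : List Letter → ℕ → ℕ → List ℕ
Fidx w a b =
  let r' = ρ w a ⊔ ρ w (suc a) ; s' = κ w b ⊓ κ w (suc b)
      r'' = ρ w a ⊓ ρ w (suc a) ; s'' = κ w b ⊔ κ w (suc b)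
      base = bends w r' s' ++ endpoints r'' s''
             ++ filterᵇ (λ k → elemᵇ k (bends w r'' s'')) (endpoints r' s')
      l = length w
      base₁ = if modR w b then filterᵇ (λ k → not (k ≡ᵇ suc l)) base else base
  in if modL w a then filterᵇ (λ k → not (k ≡ᵇ 1)) base₁ else base₁

module WithRing {c ℓ} (R : CommutativeRing c ℓ) where
  open CommutativeRing R hiding (_+_)
  open CommutativeRing R using () renaming (_+_ to _+R_)

  -- a piece (domino or block) as cells (dx , dy , value), dy measured upwards
  record Piece : Set c where
    field
      width height : ℕ
      cells : List (ℕ × ℕ × Carrier)
  open Piece public

  module _ (a : ℤ → ℤ → Carrier) where
    A : ℕ → ℕ → Carrier
    A x y = a (+ x) (+ y)

    block : ℕ × ℕ → Piece
    block (x , y) = record { width = 2 ; height = 2 ; cells =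
      (0 , 0 , A x y) ∷ (1 , 0 , A (suc x) y) ∷
      (0 , 1 , A x (suc y)) ∷ (1 , 1 , A (suc x) (suc y)) ∷ [] }

    hMinus hPlus vMinus vPlus : ℕ × ℕ → Piece
    hMinus (x , y) = record { width = 2 ; height = 1 ; cells =
      (0 , 0 , A x y) ∷ (1 , 0 , A (suc x) y) ∷ [] }
    hPlus (x , y) = record { width = 2 ; height = 1 ; cells =
      (0 , 0 , A x (suc y)) ∷ (1 , 0 , A (suc x) (suc y)) ∷ [] }
    vMinus (x , y) = record { width = 1 ; height = 2 ; cells =
      (0 , 0 , A x y) ∷ (0 , 1 , A x (suc y)) ∷ [] }
    vPlus (x , y) = record { width = 1 ; height = 2 ; cells =
      (0 , 0 , A (suc x) y) ∷ (0 , 1 , A (suc x) (suc y)) ∷ [] }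

    -- Δ_k = det B(P_k)
    Δ : List Letter → ℕ → Carrier
    Δ w k with P w k
    ... | (x , y) = A x (suc y) * A (suc x) y - A (suc x) (suc y) * A x y

  -- place pieces successively; Bool = "next piece goes above"
  placeAll : Bool → ℕ → ℕ → Piece → List Piece → List (ℕ × ℕ × Piece)
  placeAll dir x y X [] = (x , y , X) ∷ []
  placeAll true x y X (Y ∷ Ys) = (x , y , X) ∷ placeAll false x (y + height X) Y Ys
  placeAll false x y X (Y ∷ Ys) = (x , y , X) ∷ placeAll true (x + width X) y Y Ys

  -- X_0 at the origin; first direction "above" iff X_0 is a horizontal domino
  placeDRH : Piece → List Piece → List (ℕ × ℕ × Piece)
  placeDRH X Xs = placeAll (height X ≡ᵇ 1) 0 0 X Xs

  drhWidth drhHeight : List (ℕ × ℕ × Piece) → ℕ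
  drhWidth = foldr (λ { (x , y , X) m → (x + width X) ⊔ m }) 0
  drhHeight = foldr (λ { (x , y , X) m → (y + height X) ⊔ m }) 0

  cellVal : ℕ → ℕ → ℕ → ℕ → List (ℕ × ℕ × Carrier) → Carrier → Carrier
  cellVal px py X Y [] d = d
  cellVal px py X Y ((dx , dy , v) ∷ cs) d =
    if ((px + dx) ≡ᵇ X) ∧ ((py + dy) ≡ᵇ Y) then v else cellVal px py X Y cs d

  planeVal : List (ℕ × ℕ × Piece) → ℕ → ℕ → Carrier
  planeVal [] X Y = 0#
  planeVal ((px , py , Pc) ∷ ps) X Y = cellVal px py X Y (cells Pc) (planeVal ps X Y)

  -- matrix entry (i , j): row i counted from the top (0-based), column j from the left
  drhMatrix : List (ℕ × ℕ × Piece) → ℕ → ℕ → Carrier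
  drhMatrix ps i j = planeVal ps j (drhHeight ps ∸ suc i)

  sgn : ℕ → Carrier
  sgn zero = 1#
  sgn (suc n) = - sgn n

  sumTo : ℕ → (ℕ → Carrier) → Carrier
  sumTo zero f = 0#
  sumTo (suc n) f = sumTo n f +R f n

  minor : ℕ → (ℕ → ℕ → Carrier) → ℕ → ℕ → Carrier
  minor j M i k = M (suc i) (if k <ᵇ j then k else suc k)

  det : ℕ → (ℕ → ℕ → Carrier) → Carrier
  det zero M = 1#
  det (suc n) M = sumTo (suc n) (λ j → sgn j * (M 0 j * det n (minor j M)))

  module _ (a : ℤ → ℤ → Carrier) where
    stdPieces : List Letter → ℕ → ℕ → List (ℕ × ℕ × Piece)
    stdPieces w r s = placeDRH X₀ (map (λ k → block a (P w k)) (bends w r s) ++ (Xₘ ∷ []))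
      where
      X₀ = if isN (letter w r) then hMinus a (P w r) else vMinus a (P w r)
      Xₘ = if isN (letter w s) then hPlus a (P w (suc s)) else vPlus a (P w (suc s))

    cc : List Letter → ℕ → ℕ → Carrier
    cc w r s = sgn (((η ∸ 1) Nat.* (η ∸ 2)) / 2) * det η (drhMatrix ps)
      where
      ps = stdPieces w r s
      η = drhWidth ps

    prodF : List Letter → ℕ → ℕ → Carrier
    prodF w i j =
      foldr _*_ 1# (map (Δ a w) (Fidx w i j))
      * (if modR w j then A a (pp w) (qq w) else 1#)
      * (if modL w i then A a 1 1 else 1#)

{-# OPTIONS --safe #-}

-- Expanding det Std([r,s]) along its first domino (the bottom row or the left column) merges that
-- domino with the next block into one domino. Hence c([r,s]) = ω(x_r, T_{k₁} ⋯ T_{kₘ} y_s), where ω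
-- is a nondegenerate bilinear form on pairs, x_r and y_s are the end dominoes, and T_k is a 2 × 2
-- matrix built from B(P_k) with det T_k = −Δ_k. After transport to the common part μ′ the left side
-- is a 2 × 2 minor of a product, so it is the product of the Δ_k over the bends of μ′ and of two
-- boundary determinants. Consecutive entries of ρ (or κ) are either consecutive occurrences of one
-- letter, which leaves at most two bends between them, or the first (last) occurrences of both
-- letters; the boundary determinants are then Δ's of endpoints and bends, or contain a₁₁ (a_pq).

module Submission where

open import Defs
open import Algebra.Bundles using (CommutativeRing; RawRing)
import Algebra.Properties.Ring as RingProperties
import Algebra.Properties.Semiring.Mult.TCOptimised as Multiples
import Algebra.Solver.Ring as RingSolver
open import Algebra.Solver.Ring.AlmostCommutativeRing
  using (fromCommutativeRing; _-Raw-AlmostCommutative⟶_; Induced-equivalence)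
open import Data.Bool using (Bool; true; false; if_then_else_; _∧_; not)
open import Data.Empty using (⊥-elim)
open import Data.Integer as ℤ using (ℤ; +_; -[1+_]; _⊖_; _◃_)
import Data.Integer.Properties as ℤₚ
open import Data.List
  using (List; []; _∷_; _++_; _∷ʳ_; map; length; foldr; filterᵇ; iterate; applyUpTo; reverse; head; last)
import Data.List.Properties as Listₚ
open import Data.List.Relation.Unary.Linked as Linked using (Linked; []; [-]; _∷_; _∷′_; head′)
import Data.List.Relation.Unary.Linked.Properties as Linkedₚ
open import Data.Maybe using (just; nothing)
open import Data.Maybe.Relation.Binary.Connected as Connected using (Connected; just; just-nothing; nothing-just; nothing)
open import Data.Nat as ℕ using (ℕ; zero; suc; _≤_; _<_; z≤n; s≤s; _∸_; _⊔_; _⊓_; _≡ᵇ_; _<ᵇ_)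
open import Data.Nat.DivMod using (+-distrib-/-∣ʳ; m*n/n≡m)
open import Data.Nat.Divisibility using (divides-refl)
import Data.Nat.Properties as ℕₚ
open import Data.Nat.Tactic.RingSolver using (solve-∀)
open import Data.Product using (_×_; _,_; proj₁; proj₂)
import Data.Sign as Sign
open import Data.Sum using (inj₁; inj₂)
open import Function using (flip; _∘_)
import Level
open import Relation.Binary.Definitions using (WeaklyDecidable; tri<; tri≈; tri>)
open import Relation.Binary.PropositionalEquality as ≡ using (_≡_; _≢_)
open import Relation.Nullary using (yes; no)

-- `det` expands along the top row, while the word starts at the bottom left, so expansions at that
-- end are derived separately, for rows and columns with at most two nonzero entries. The exponent
-- (η-1)(η-2)/2 is a triangular number. Its increment and the sign of the expansion differ in parity
-- by one, so each step contributes a constant -1, absorbed by the order of the factors in `ω`; the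
-- recursion is then free of signs. Each T_k still has determinant -Δ_k, which leaves a sign given
-- by the parity of the number of bends of μ′. Letters alternate at bends, so the two end letters of
-- μ′ determine this parity. The listings ρ and κ, one letter descending and the other ascending,
-- make the same two letters determine whether rows or columns of the minor are interchanged, and
-- the signs cancel. At the left end, modulo the functional of the inner domino, the outer
-- functional is -t times that of the opposite edge. If a bend intervenes, t is Δ of the outer index
-- when an earlier letter of the same kind starts there, and t is a₁₁ when the word itself starts
-- there: this is the origin of the exceptional factor.

-- A ring solver with integer coefficients over an arbitrary commutative ring.

module IntegerCoefficients {c ℓ} (R : CommutativeRing c ℓ) where
  open CommutativeRing R
  open RingProperties ring using (-‿+-comm; -‿distribˡ-*; -‿distribʳ-*; -‿involutive; -0#≈0#)
  open Multiples semiring using (×-homo-+; ×1-homo-*; 1+×) renaming (_×_ to _×ᵣ_)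
  open import Relation.Binary.Reasoning.Setoid setoid

  -- Equality in `R` need not be decidable, so polynomials are normalised over the integers. With
  -- the optimised multiples `⟦ + 1 ⟧ℤ` computes to `1#`, so `con (+ 1)` in a solver equation stands
  -- for `1#` itself.
  ⟦_⟧ℤ : ℤ → Carrier
  ⟦ + n ⟧ℤ = n ×ᵣ 1#
  ⟦ -[1+ n ] ⟧ℤ = - (suc n ×ᵣ 1#)

  cancel : ∀ x y z → (x + y) - (x + z) ≈ y - z
  cancel x y z = begin
    (x + y) - (x + z)       ≈⟨ +-cong (+-comm y x) (-‿+-comm x z) ⟨
    (y + x) + (- x - z)     ≈⟨ +-assoc y x _ ⟩
    y + (x + (- x - z))     ≈⟨ +-congˡ (+-assoc x (- x) (- z)) ⟨
    y + ((x - x) - z)       ≈⟨ +-congˡ (+-congʳ (-‿inverseʳ x)) ⟩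
    y + (0# - z)            ≈⟨ +-congˡ (+-identityˡ _) ⟩
    y - z                   ∎

  ⊖-homo : ∀ m n → ⟦ m ⊖ n ⟧ℤ ≈ m ×ᵣ 1# - n ×ᵣ 1#
  ⊖-homo m zero = sym (trans (+-congˡ -0#≈0#) (+-identityʳ _))
  ⊖-homo zero (suc n) = sym (+-identityˡ _)
  ⊖-homo (suc m) (suc n) = begin
    ⟦ suc m ⊖ suc n ⟧ℤ               ≡⟨ ≡.cong ⟦_⟧ℤ (ℤₚ.[1+m]⊖[1+n]≡m⊖n m n) ⟩
    ⟦ m ⊖ n ⟧ℤ                       ≈⟨ ⊖-homo m n ⟩
    m ×ᵣ 1# - n ×ᵣ 1#                  ≈⟨ cancel 1# _ _ ⟨
    (1# + m ×ᵣ 1#) - (1# + n ×ᵣ 1#)    ≈⟨ +-cong (1+× m 1#) (-‿cong (1+× n 1#)) ⟨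
    suc m ×ᵣ 1# - suc n ×ᵣ 1#          ∎

  +-homo : ∀ i j → ⟦ i ℤ.+ j ⟧ℤ ≈ ⟦ i ⟧ℤ + ⟦ j ⟧ℤ
  +-homo (+ m) (+ n) = ×-homo-+ 1# m n
  +-homo (+ m) -[1+ n ] = ⊖-homo m (suc n)
  +-homo -[1+ m ] (+ n) = trans (⊖-homo n (suc m)) (+-comm _ _)
  +-homo -[1+ m ] -[1+ n ] = begin
    - (suc (suc (m ℕ.+ n)) ×ᵣ 1#)         ≡⟨ ≡.cong (λ k → - (k ×ᵣ 1#)) (ℕₚ.+-suc (suc m) n) ⟨
    - ((suc m ℕ.+ suc n) ×ᵣ 1#)           ≈⟨ -‿cong (×-homo-+ 1# (suc m) (suc n)) ⟩
    - (suc m ×ᵣ 1# + suc n ×ᵣ 1#)          ≈⟨ -‿+-comm _ _ ⟨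
    - (suc m ×ᵣ 1#) - (suc n ×ᵣ 1#)        ∎

  -◃-homo : ∀ n → ⟦ Sign.- ◃ n ⟧ℤ ≈ - (n ×ᵣ 1#)
  -◃-homo zero = sym -0#≈0#
  -◃-homo (suc n) = refl

  *-homo : ∀ i j → ⟦ i ℤ.* j ⟧ℤ ≈ ⟦ i ⟧ℤ * ⟦ j ⟧ℤ
  *-homo (+ m) (+ n) = trans (reflexive (≡.cong ⟦_⟧ℤ (ℤₚ.+◃n≡+n (m ℕ.* n)))) (×1-homo-* m n)
  *-homo (+ m) -[1+ n ] = begin
    ⟦ Sign.- ◃ (m ℕ.* suc n) ⟧ℤ        ≈⟨ -◃-homo (m ℕ.* suc n) ⟩
    - ((m ℕ.* suc n) ×ᵣ 1#)             ≈⟨ -‿cong (×1-homo-* m (suc n)) ⟩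
    - (m ×ᵣ 1# * suc n ×ᵣ 1#)            ≈⟨ -‿distribʳ-* _ _ ⟩
    m ×ᵣ 1# * - (suc n ×ᵣ 1#)            ∎
  *-homo -[1+ m ] (+ n) = begin
    ⟦ Sign.- ◃ (suc m ℕ.* n) ⟧ℤ        ≈⟨ -◃-homo (suc m ℕ.* n) ⟩
    - ((suc m ℕ.* n) ×ᵣ 1#)             ≈⟨ -‿cong (×1-homo-* (suc m) n) ⟩
    - (suc m ×ᵣ 1# * n ×ᵣ 1#)            ≈⟨ -‿distribˡ-* _ _ ⟩
    - (suc m ×ᵣ 1#) * n ×ᵣ 1#            ∎
  *-homo -[1+ m ] -[1+ n ] = begin
    (suc m ℕ.* suc n) ×ᵣ 1#             ≈⟨ ×1-homo-* (suc m) (suc n) ⟩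
    suc m ×ᵣ 1# * suc n ×ᵣ 1#            ≈⟨ -‿involutive _ ⟨
    - - (suc m ×ᵣ 1# * suc n ×ᵣ 1#)      ≈⟨ -‿cong (-‿distribʳ-* _ _) ⟩
    - (suc m ×ᵣ 1# * - (suc n ×ᵣ 1#))    ≈⟨ -‿distribˡ-* _ _ ⟩
    - (suc m ×ᵣ 1#) * - (suc n ×ᵣ 1#)    ∎

  -‿homo : ∀ i → ⟦ ℤ.- i ⟧ℤ ≈ - ⟦ i ⟧ℤ
  -‿homo (+ zero) = sym -0#≈0#
  -‿homo (+ suc n) = refl
  -‿homo -[1+ n ] = sym (-‿involutive _)

  coefficients : RawRing _ _
  coefficients = CommutativeRing.rawRing ℤₚ.+-*-commutativeRing

  morphism : coefficients -Raw-AlmostCommutative⟶ fromCommutativeRing R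
  morphism = record
    { ⟦_⟧ = ⟦_⟧ℤ ; +-homo = +-homo ; *-homo = *-homo ; -‿homo = -‿homo ; 0-homo = refl ; 1-homo = refl }

  _≟c_ : WeaklyDecidable (Induced-equivalence morphism)
  i ≟c j with i ℤ.≟ j
  ... | yes i≡j = just (reflexive (≡.cong ⟦_⟧ℤ i≡j))
  ... | no  _   = nothing

  open RingSolver coefficients (fromCommutativeRing R) morphism _≟c_ public
    using (solve; _:=_; con; _:+_; _:*_; :-_; _:-_)

-- Expansion along a sparse bottom row or left column.

module Determinants {c ℓ} (R : CommutativeRing c ℓ) where
  open CommutativeRing R
  open WithRing R using (sgn; sumTo; minor; det)
  open IntegerCoefficients R using (solve; _:=_; con; _:+_; _:*_; :-_; _:-_)
  open import Relation.Binary.Reasoning.Setoid setoid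

  Matrix : Set c
  Matrix = ℕ → ℕ → Carrier

  -- The column renumbering inside `minor`, named so that composites of deletions can be compared.
  skip : ℕ → ℕ → ℕ
  skip j k = if k <ᵇ j then k else suc k

  skip-suc : ∀ j k → skip (suc j) (suc k) ≡ suc (skip j k)
  skip-suc j k with k <ᵇ j
  ... | true = ≡.refl
  ... | false = ≡.refl

  skip-< : ∀ j {k n} → k < n → skip j k < suc n
  skip-< j {k} k<n with k <ᵇ j
  ... | true = ℕₚ.m<n⇒m<1+n k<n
  ... | false = s≤s k<n

  sumTo-cong : ∀ n {f g} → (∀ k → k < n → f k ≈ g k) → sumTo n f ≈ sumTo n g
  sumTo-cong zero f≈g = refl
  sumTo-cong (suc n) f≈g =
    +-cong (sumTo-cong n (λ k k<n → f≈g k (ℕₚ.m<n⇒m<1+n k<n))) (f≈g n ℕₚ.≤-refl)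

  sumTo-zero : ∀ n {f} → (∀ k → k < n → f k ≈ 0#) → sumTo n f ≈ 0#
  sumTo-zero zero f≈0 = refl
  sumTo-zero (suc n) f≈0 =
    trans (+-cong (sumTo-zero n (λ k k<n → f≈0 k (ℕₚ.m<n⇒m<1+n k<n))) (f≈0 n ℕₚ.≤-refl)) (+-identityˡ 0#)

  sumTo-suc : ∀ n f → sumTo (suc n) f ≈ f 0 + sumTo n (λ k → f (suc k))
  sumTo-suc zero f = +-comm _ _
  sumTo-suc (suc n) f = trans (+-congʳ (sumTo-suc n f)) (+-assoc _ _ _)

  sumTo-linear : ∀ n p q f g → sumTo n (λ k → p * f k + q * g k) ≈ p * sumTo n f + q * sumTo n g
  sumTo-linear zero p q f g = solve 2 (λ p q → con (+ 0) := p :* con (+ 0) :+ q :* con (+ 0)) refl p q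
  sumTo-linear (suc n) p q f g = trans (+-congʳ (sumTo-linear n p q f g))
    (solve 6 (λ p q F G f g → (p :* F :+ q :* G) :+ (p :* f :+ q :* g) := p :* (F :+ f) :+ q :* (G :+ g)) refl
      p q (sumTo n f) (sumTo n g) (f n) (g n))

  det-cong : ∀ n {M M′} → (∀ i j → i < n → j < n → M i j ≈ M′ i j) → det n M ≈ det n M′
  det-cong zero M≈M′ = refl
  det-cong (suc n) M≈M′ = sumTo-cong (suc n) λ j j<n →
    *-congˡ (*-cong (M≈M′ 0 j (s≤s z≤n) j<n)
      (det-cong n λ i k i<n k<n → M≈M′ _ _ (s≤s i<n) (skip-< j k<n)))

  det-≡ : ∀ n {M M′} → (∀ i j → M i j ≡ M′ i j) → det n M ≈ det n M′
  det-≡ n M≡M′ = det-cong n λ i j _ _ → reflexive (M≡M′ i j)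

  -- The tail of the top-row expansion in `det-bottom-row-2`. Columns from 2 on move one place to
  -- the left when column 0 or 1 is deleted, so each sign changes once; this is the factor `- s`.
  sumTo-alternating : ∀ n s p q (x A B : ℕ → Carrier) →
    sumTo n (λ k → sgn (suc (suc k)) * (x k * (s * (p * A k - q * B k))))
      ≈ - s * (p * sumTo n (λ k → sgn (suc k) * (x k * A k)) - q * sumTo n (λ k → sgn (suc k) * (x k * B k)))
  sumTo-alternating n s p q x A B = begin
    sumTo n (λ k → sgn (suc (suc k)) * (x k * (s * (p * A k - q * B k))))
      ≈⟨ sumTo-cong n (λ k _ → solve 7
           (λ g x s p A q B → :- (:- g) :* (x :* (s :* (p :* A :- q :* B)))
             := (:- s :* p) :* (:- g :* (x :* A)) :+ (s :* q) :* (:- g :* (x :* B)))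
           refl (sgn k) (x k) s p (A k) q (B k)) ⟩
    sumTo n (λ k → (- s * p) * (sgn (suc k) * (x k * A k)) + (s * q) * (sgn (suc k) * (x k * B k)))
      ≈⟨ sumTo-linear n _ _ _ _ ⟩
    (- s * p) * _ + (s * q) * _
      ≈⟨ solve 5 (λ s p q F G → (:- s :* p) :* F :+ (s :* q) :* G := :- s :* (p :* F :- q :* G)) refl s p q _ _ ⟩
    - s * (p * _ - q * _) ∎

  dropColumn : ℕ → Matrix → Matrix
  dropColumn k M i j = M i (skip k j)

  dropRow : ℕ → Matrix → Matrix
  dropRow k M i j = M (skip k i) j

  -- The numeral counts the leading entries of the bottom row that may be nonzero.

  det-bottom-row-0 : ∀ n M → (∀ k → k < suc n → M n k ≈ 0#) → det (suc n) M ≈ 0#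
  det-bottom-row-0 n M row≈0 = sumTo-zero (suc n) λ j j<n → trans (*-congˡ (lemma n M row≈0 j j<n)) (zeroʳ _)
    where
    lemma : ∀ n M → (∀ k → k < suc n → M n k ≈ 0#) → ∀ j → j < suc n → M 0 j * det n (minor j M) ≈ 0#
    lemma zero M row≈0 j j<n = trans (*-congʳ (row≈0 j j<n)) (zeroˡ _)
    lemma (suc n) M row≈0 j _ =
      trans (*-congˡ (det-bottom-row-0 n (minor j M) λ k k<n → row≈0 _ (skip-< j k<n))) (zeroʳ _)

  det-bottom-row-1 : ∀ n M → (∀ k → k < n → M n (suc k) ≈ 0#) →
    det (suc n) M ≈ sgn n * (M n 0 * det n (dropColumn 0 M))
  det-bottom-row-1 zero M row≈0 = +-identityˡ _
  det-bottom-row-1 (suc n) M row≈0 = begin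
    det (suc (suc n)) M
      ≈⟨ sumTo-suc (suc n) _ ⟩
    1# * (M 0 0 * det (suc n) (minor 0 M)) + sumTo (suc n) (λ k → sgn (suc k) * (M 0 (suc k) * det (suc n) (minor (suc k) M)))
      ≈⟨ +-cong
           (trans (*-congˡ (trans (*-congˡ (det-bottom-row-0 n (minor 0 M) row≈0)) (zeroʳ _))) (zeroʳ _))
           (sumTo-cong (suc n) λ k _ → trans
             (*-congˡ (*-congˡ (det-bottom-row-1 n (minor (suc k) M) λ i i<n →
               trans (reflexive (≡.cong (M (suc n)) (skip-suc k i))) (row≈0 _ (skip-< k i<n)))))
             (trans
               (*-congˡ (*-congˡ (*-congˡ (*-congˡ (det-≡ n λ i j → ≡.cong (M (suc i)) (skip-suc k j))))))
               (solve 5 (λ g x s m d → :- g :* (x :* (s :* (m :* d))) := (:- s :* m) :* (g :* (x :* d)) :+ con (+ 0) :* con (+ 0))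
                 refl (sgn k) _ (sgn n) _ _))) ⟩
    0# + sumTo (suc n) (λ k → (- sgn n * M (suc n) 0) * (sgn k * (M 0 (suc k) * det n (minor k (dropColumn 0 M)))) + 0# * 0#)
      ≈⟨ +-identityˡ _ ⟩
    _ ≈⟨ sumTo-linear (suc n) _ _ _ _ ⟩
    (- sgn n * M (suc n) 0) * det (suc n) (dropColumn 0 M) + 0# * _
      ≈⟨ solve 4 (λ s m d t → (:- s :* m) :* d :+ con (+ 0) :* t := :- s :* (m :* d)) refl _ _ _ _ ⟩
    sgn (suc n) * (M (suc n) 0 * det (suc n) (dropColumn 0 M)) ∎

  -- In the top-row expansion the minors of columns 0 and 1 keep one nonzero bottom entry and fall
  -- under `det-bottom-row-1`; the other minors keep both, and induction applies. The two special
  -- minors become the leading terms of the two cofactors, in exchanged order.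
  det-bottom-row-2 : ∀ n M → (∀ k → k < n → M (suc n) (suc (suc k)) ≈ 0#) →
    det (suc (suc n)) M ≈
      sgn (suc n) * (M (suc n) 0 * det (suc n) (dropColumn 0 M) - M (suc n) 1 * det (suc n) (dropColumn 1 M))
  det-bottom-row-2 zero M row≈0 = solve 4
    (λ a b c d → con (+ 0) :+ con (+ 1) :* (a :* (con (+ 0) :+ con (+ 1) :* (d :* con (+ 1))))
        :+ :- con (+ 1) :* (b :* (con (+ 0) :+ con (+ 1) :* (c :* con (+ 1))))
      := :- con (+ 1) :* (c :* (con (+ 0) :+ con (+ 1) :* (b :* con (+ 1)))
        :- d :* (con (+ 0) :+ con (+ 1) :* (a :* con (+ 1)))))
    refl (M 0 0) (M 0 1) (M 1 0) (M 1 1)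
  det-bottom-row-2 (suc n) M row≈0 = begin
    det (suc (suc (suc n))) M
      ≈⟨ trans (sumTo-suc (suc (suc n)) _) (+-congˡ (sumTo-suc (suc n) _)) ⟩
    1# * (M 0 0 * det (suc (suc n)) (minor 0 M)) + (- 1# * (M 0 1 * det (suc (suc n)) (minor 1 M))
      + sumTo (suc n) (λ k → sgn (suc (suc k)) * (M 0 (suc (suc k)) * det (suc (suc n)) (minor (suc (suc k)) M))))
      ≈⟨ +-cong (*-congˡ (*-congˡ (det-bottom-row-1 (suc n) (minor 0 M) row≈0)))
           (+-cong (*-congˡ (*-congˡ (det-bottom-row-1 (suc n) (minor 1 M) row≈0)))
             (sumTo-cong (suc n) λ k _ → *-congˡ (*-congˡ (trans
               (det-bottom-row-2 n (minor (suc (suc k)) M) λ i i<n →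
                 trans (reflexive (≡.cong (M (suc (suc n))) (skip-suc₂ k i))) (row≈0 _ (skip-< k i<n)))
               (*-congˡ (+-cong
                 (*-congˡ (det-≡ (suc n) λ i j → ≡.cong (M (suc i)) (skip-suc (suc k) j)))
                 (-‿cong (*-congˡ (det-≡ (suc n) λ i j → ≡.cong (M (suc i)) (columns k j)))))))))) ⟩
    1# * (M 0 0 * (s * (q * D))) + (- 1# * (M 0 1 * (s * (p * D)))
      + sumTo (suc n) (λ k → sgn (suc (suc k)) * (x k * (s * (p * A k - q * B k)))))
      ≈⟨ +-congˡ (+-congˡ (sumTo-alternating (suc n) s p q x A B)) ⟩
    1# * (M 0 0 * (s * (q * D))) + (- 1# * (M 0 1 * (s * (p * D)))
      + - s * (p * sumTo (suc n) (λ k → sgn (suc k) * (x k * A k)) - q * sumTo (suc n) (λ k → sgn (suc k) * (x k * B k))))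
      ≈⟨ solve 8 (λ a b s p q D F G →
           con (+ 1) :* (a :* (s :* (q :* D))) :+ (:- con (+ 1) :* (b :* (s :* (p :* D))) :+ :- s :* (p :* F :- q :* G))
           := :- s :* (p :* (con (+ 1) :* (b :* D) :+ F) :- q :* (con (+ 1) :* (a :* D) :+ G)))
           refl (M 0 0) (M 0 1) s p q D _ _ ⟩
    - s * (p * (1# * (M 0 1 * D) + sumTo (suc n) (λ k → sgn (suc k) * (x k * A k)))
         - q * (1# * (M 0 0 * D) + sumTo (suc n) (λ k → sgn (suc k) * (x k * B k))))
      ≈⟨ *-congˡ (+-cong (*-congˡ (sumTo-suc (suc n) _)) (-‿cong (*-congˡ (sumTo-suc (suc n) _)))) ⟨
    - s * (p * det (suc (suc n)) (dropColumn 0 M) - q * det (suc (suc n)) (dropColumn 1 M)) ∎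
    where
    s = sgn (suc n)
    p = M (suc (suc n)) 0
    q = M (suc (suc n)) 1
    D = det (suc n) (λ i j → M (suc i) (suc (suc j)))
    x A B : ℕ → Carrier
    x k = M 0 (suc (suc k))
    A k = det (suc n) (minor (suc k) (dropColumn 0 M))
    B k = det (suc n) (minor (suc k) (dropColumn 1 M))
    skip-suc₂ : ∀ k i → skip (suc (suc k)) (suc (suc i)) ≡ suc (suc (skip k i))
    skip-suc₂ k i = ≡.trans (skip-suc (suc k) (suc i)) (≡.cong suc (skip-suc k i))
    -- Two deletions commute once the later column is renumbered from `k + 2` to `k + 1`.
    columns : ∀ k j → skip (suc (suc k)) (skip 1 j) ≡ skip 1 (skip (suc k) j)
    columns k zero = ≡.refl
    columns k (suc j) = ≡.trans (skip-suc₂ k j) (≡.cong (skip 1) (≡.sym (skip-suc k j)))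

  -- In the inductive case `M 0 0` vanishes, and every other minor of the top row keeps the last two
  -- entries of the left column.
  det-left-column-2 : ∀ n M → (∀ i → i < n → M i 0 ≈ 0#) →
    det (suc (suc n)) M ≈ sgn (suc n) *
      (M (suc n) 0 * det (suc n) (dropColumn 0 M) - M n 0 * det (suc n) (dropRow n (dropColumn 0 M)))
  det-left-column-2 zero M column≈0 = solve 4
    (λ a b c d → con (+ 0) :+ con (+ 1) :* (a :* (con (+ 0) :+ con (+ 1) :* (d :* con (+ 1))))
        :+ :- con (+ 1) :* (b :* (con (+ 0) :+ con (+ 1) :* (c :* con (+ 1))))
      := :- con (+ 1) :* (c :* (con (+ 0) :+ con (+ 1) :* (b :* con (+ 1)))
        :- a :* (con (+ 0) :+ con (+ 1) :* (d :* con (+ 1)))))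
    refl (M 0 0) (M 0 1) (M 1 0) (M 1 1)
  det-left-column-2 (suc n) M column≈0 = begin
    det (suc (suc (suc n))) M
      ≈⟨ sumTo-suc (suc (suc n)) _ ⟩
    1# * (M 0 0 * det (suc (suc n)) (minor 0 M))
      + sumTo (suc (suc n)) (λ k → sgn (suc k) * (M 0 (suc k) * det (suc (suc n)) (minor (suc k) M)))
      ≈⟨ +-cong
           (trans (*-congˡ (trans (*-congʳ (column≈0 0 (s≤s z≤n))) (zeroˡ _))) (zeroʳ _))
           (sumTo-cong (suc (suc n)) λ k _ → *-congˡ (*-congˡ (trans
             (det-left-column-2 n (minor (suc k) M) λ i i<n → column≈0 (suc i) (s≤s i<n))
             (*-congˡ (+-cong
               (*-congˡ (det-≡ (suc n) λ i j → ≡.cong (M (suc i)) (skip-suc k j)))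
               (-‿cong (*-congˡ (det-≡ (suc n) λ i j →
                 ≡.cong₂ M (≡.sym (skip-suc n i)) (skip-suc k j))))))))) ⟩
    0# + sumTo (suc (suc n)) (λ k → - sgn k * (x k * (s * (p * A k - q * B k))))
      ≈⟨ +-congˡ (sumTo-cong (suc (suc n)) λ k _ → solve 7
           (λ g x s p A q B → :- g :* (x :* (s :* (p :* A :- q :* B)))
             := (:- s :* p) :* (g :* (x :* A)) :+ (s :* q) :* (g :* (x :* B)))
           refl (sgn k) (x k) s p (A k) q (B k)) ⟩
    0# + sumTo (suc (suc n)) (λ k → (- s * p) * (sgn k * (x k * A k)) + (s * q) * (sgn k * (x k * B k)))
      ≈⟨ +-congˡ (sumTo-linear (suc (suc n)) _ _ _ _) ⟩
    0# + ((- s * p) * det (suc (suc n)) (dropColumn 0 M)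
        + (s * q) * det (suc (suc n)) (dropRow (suc n) (dropColumn 0 M)))
      ≈⟨ solve 5 (λ s p q F G → con (+ 0) :+ ((:- s :* p) :* F :+ (s :* q) :* G) := :- s :* (p :* F :- q :* G))
           refl s p q _ _ ⟩
    - s * (p * det (suc (suc n)) (dropColumn 0 M) - q * det (suc (suc n)) (dropRow (suc n) (dropColumn 0 M))) ∎
    where
    s = sgn (suc n)
    p = M (suc (suc n)) 0
    q = M (suc n) 0
    x A B : ℕ → Carrier
    x k = M 0 (suc k)
    A k = det (suc n) (minor k (dropColumn 0 M))
    B k = det (suc n) (minor k (dropRow (suc n) (dropColumn 0 M)))

other : Letter → Letter
other N = E
other E = N

-- The sign exponent in the definition of c.

module Signs {c ℓ} (R : CommutativeRing c ℓ) where
  open CommutativeRing R hiding (zero)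
  open WithRing R using (sgn)
  open IntegerCoefficients R using (solve; _:=_; con; _:+_; _:*_; :-_; _:-_)

  sgn-+ : ∀ m n → sgn (m ℕ.+ n) ≈ sgn m * sgn n
  sgn-+ zero n = sym (*-identityˡ _)
  sgn-+ (suc m) n = trans (-‿cong (sgn-+ m n)) (solve 2 (λ s t → :- (s :* t) := :- s :* t) refl _ _)

  sgn-square : ∀ n → sgn n * sgn n ≈ 1#
  sgn-square zero = *-identityˡ 1#
  sgn-square (suc n) = trans (solve 1 (λ s → :- s :* :- s := s :* s) refl _) (sgn-square n)

  -- The exponent (η-1)(η-2)/2 for η = m + 2, where `m` counts the bends.
  triangle : ℕ → ℕ
  triangle m = (suc m ℕ.* m) ℕ./ 2

  triangle-suc : ∀ m → triangle (suc m) ≡ triangle m ℕ.+ suc m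
  triangle-suc m = begin
    (suc (suc m) ℕ.* suc m) ℕ./ 2          ≡⟨ ≡.cong (ℕ._/ 2) (expand m) ⟩
    (suc m ℕ.* m ℕ.+ suc m ℕ.* 2) ℕ./ 2    ≡⟨ +-distrib-/-∣ʳ (suc m ℕ.* m) (divides-refl (suc m)) ⟩
    triangle m ℕ.+ (suc m ℕ.* 2) ℕ./ 2     ≡⟨ ≡.cong (triangle m ℕ.+_) (m*n/n≡m (suc m) 2) ⟩
    triangle m ℕ.+ suc m                   ∎
    where
    open ≡.≡-Reasoning
    expand : ∀ m → suc (suc m) ℕ.* suc m ≡ suc m ℕ.* m ℕ.+ suc m ℕ.* 2
    expand = solve-∀

  sgn-triangle-suc : ∀ m → sgn (triangle (suc m)) ≈ sgn (triangle m) * sgn (suc m)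
  sgn-triangle-suc m = trans (reflexive (≡.cong sgn (triangle-suc m))) (sgn-+ (triangle m) (suc m))

-- Determinants of domino-block staircases.

module Staircases {c ℓ} (R : CommutativeRing c ℓ) (a : ℤ → ℤ → CommutativeRing.Carrier R) where
  open CommutativeRing R hiding (zero)
  open WithRing R
  open IntegerCoefficients R using (solve; _:=_; con; _:+_; _:*_; :-_; _:-_)
  open Determinants R
  open Signs R

  Vector : Set c
  Vector = Carrier × Carrier

  domino : Letter → Vector → Piece
  domino N (u₁ , u₂) = record { width = 2 ; height = 1 ; cells = (0 , 0 , u₁) ∷ (1 , 0 , u₂) ∷ [] }
  domino E (u₁ , u₂) = record { width = 1 ; height = 2 ; cells = (0 , 0 , u₁) ∷ (0 , 1 , u₂) ∷ [] }

  -- lo N, hi N are the rows h₋, h₊ of B(p) and lo E, hi E its columns v₋, v₊; columns are read bottom to top.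
  lo hi : Letter → ℕ × ℕ → Vector
  lo N (x , y) = A a x y , A a (suc x) y
  lo E (x , y) = A a x y , A a x (suc y)
  hi N (x , y) = A a x (suc y) , A a (suc x) (suc y)
  hi E (x , y) = A a (suc x) y , A a (suc x) (suc y)

  -- The determinant of the 2 × 2 matrix formed by `u` and then `x`, above it or to its right.
  -- Reading columns from bottom to top gives both arrangements the same sign, so `ω` carries no
  -- letter.
  ω : Vector → Vector → Carrier
  ω (u₁ , u₂) (x₁ , x₂) = u₂ * x₁ - u₁ * x₂

  -- Directions alternate, so the number of blocks fixes the shape of the final domino.
  lastLetter : ∀ {b} {B : Set b} → Letter → List B → Letter
  lastLetter L [] = L
  lastLetter L (_ ∷ ps) = lastLetter (other L) ps

  tail : Letter → List (ℕ × ℕ) → Vector → List Piece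
  tail L ps x = map (block a) ps ++ domino (lastLetter L ps) x ∷ []

  staircase : Letter → Vector → List (ℕ × ℕ) → Vector → List (ℕ × ℕ × Piece)
  staircase L u ps x = placeAll (isN L) 0 0 (domino L u) (tail L ps x)

  -- The adjoint with respect to ω of u ↦ u₂ lo − u₁ hi, the domino left after expanding along u.
  transfer : Letter → ℕ × ℕ → Vector → Vector
  transfer L p y = ω (lo L p) y , ω (hi L p) y

  pull : Letter → List (ℕ × ℕ) → Vector → Vector
  pull L [] x = x
  pull L (p ∷ ps) x = transfer (other L) p (pull (other L) ps x)

  cellVal-suc : ∀ px py X Y cs d → cellVal (suc px) (suc py) (suc X) (suc Y) cs d ≡ cellVal px py X Y cs d
  cellVal-suc px py X Y [] d = ≡.refl
  cellVal-suc px py X Y ((dx , dy , v) ∷ cs) d =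
    ≡.cong (if (px ℕ.+ dx ≡ᵇ X) ∧ (py ℕ.+ dy ≡ᵇ Y) then v else_) (cellVal-suc px py X Y cs d)

  planeVal-suc : ∀ d x y Z Zs X Y →
    planeVal (placeAll d (suc x) (suc y) Z Zs) (suc X) (suc Y) ≡ planeVal (placeAll d x y Z Zs) X Y
  planeVal-suc d x y Z [] X Y = cellVal-suc x y X Y (cells Z) 0#
  planeVal-suc true x y Z (Z′ ∷ Zs) X Y = ≡.trans (cellVal-suc x y X Y (cells Z) _)
    (≡.cong (cellVal x y X Y (cells Z)) (planeVal-suc false x (y ℕ.+ height Z) Z′ Zs X Y))
  planeVal-suc false x y Z (Z′ ∷ Zs) X Y = ≡.trans (cellVal-suc x y X Y (cells Z) _)
    (≡.cong (cellVal x y X Y (cells Z)) (planeVal-suc true (x ℕ.+ width Z) y Z′ Zs X Y))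

  ≡ᵇ-left : ∀ m d {n} → n < m → (m ℕ.+ d ≡ᵇ n) ≡ false
  ≡ᵇ-left (suc m) d (s≤s z≤n) = ≡.refl
  ≡ᵇ-left (suc m) d (s≤s (s≤s n<m)) = ≡ᵇ-left m d (s≤s n<m)

  cellVal-left : ∀ px py {X} Y cs d → X < px → cellVal px py X Y cs d ≡ d
  cellVal-left px py Y [] d X<px = ≡.refl
  cellVal-left px py {X} Y ((dx , dy , v) ∷ cs) d X<px
    rewrite ≡ᵇ-left px dx X<px = cellVal-left px py Y cs d X<px

  cellVal-below : ∀ px py X {Y} cs d → Y < py → cellVal px py X Y cs d ≡ d
  cellVal-below px py X [] d Y<py = ≡.refl
  cellVal-below px py X {Y} ((dx , dy , v) ∷ cs) d Y<py with px ℕ.+ dx ≡ᵇ X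
  ... | false = cellVal-below px py X cs d Y<py
  ... | true rewrite ≡ᵇ-left py dy Y<py = cellVal-below px py X cs d Y<py

  planeVal-left : ∀ d x y Z Zs {X} Y → X < x → planeVal (placeAll d x y Z Zs) X Y ≡ 0#
  planeVal-left d x y Z [] Y X<x = cellVal-left x y Y (cells Z) 0# X<x
  planeVal-left true x y Z (Z′ ∷ Zs) Y X<x = ≡.trans (cellVal-left x y Y (cells Z) _ X<x)
    (planeVal-left false x (y ℕ.+ height Z) Z′ Zs Y X<x)
  planeVal-left false x y Z (Z′ ∷ Zs) Y X<x = ≡.trans (cellVal-left x y Y (cells Z) _ X<x)
    (planeVal-left true (x ℕ.+ width Z) y Z′ Zs Y (ℕₚ.<-≤-trans X<x (ℕₚ.m≤m+n x _)))

  planeVal-below : ∀ d x y Z Zs X {Y} → Y < y → planeVal (placeAll d x y Z Zs) X Y ≡ 0#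
  planeVal-below d x y Z [] X Y<y = cellVal-below x y X (cells Z) 0# Y<y
  planeVal-below true x y Z (Z′ ∷ Zs) X Y<y = ≡.trans (cellVal-below x y X (cells Z) _ Y<y)
    (planeVal-below false x (y ℕ.+ height Z) Z′ Zs X (ℕₚ.<-≤-trans Y<y (ℕₚ.m≤m+n y _)))
  planeVal-below false x y Z (Z′ ∷ Zs) X Y<y = ≡.trans (cellVal-below x y X (cells Z) _ Y<y)
    (planeVal-below true (x ℕ.+ width Z) y Z′ Zs X Y<y)

  -- `placeAll` computes only when the next piece is visible. A tail always ends in a domino, so it
  -- may be assumed to be a cons, without splitting on `ps`.
  tail-cons : ∀ L ps x {q} (T : List Piece → Set q) → (∀ Z Zs → T (Z ∷ Zs)) → T (tail L ps x)
  tail-cons L [] x T f = f _ _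
  tail-cons L (p ∷ ps) x T f = f _ _

  -- Deleting the row of `u` and the left column of the block leaves its right column as a vertical
  -- domino. All later pieces lie to the right of the block, so they only shift by one in both
  -- directions. In `staircaseN-lo` the right column is deleted instead.
  staircaseN-hi : ∀ u p ps x j k →
    planeVal (staircase N u (p ∷ ps) x) (suc j) (suc k) ≡ planeVal (staircase E (hi E p) ps x) j k
  staircaseN-hi u p ps x j k = tail-cons E ps x
    (λ Zs → planeVal (placeAll true 0 0 (domino N u) (block a p ∷ Zs)) (suc j) (suc k)
      ≡ planeVal (placeAll false 0 0 (domino E (hi E p)) Zs) j k) (λ Z Zs → cases Z Zs j k)
    where
    cases : ∀ Z Zs j k → planeVal (placeAll true 0 0 (domino N u) (block a p ∷ Z ∷ Zs)) (suc j) (suc k)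
      ≡ planeVal (placeAll false 0 0 (domino E (hi E p)) (Z ∷ Zs)) j k
    cases Z Zs zero zero = ≡.refl
    cases Z Zs zero (suc zero) = ≡.refl
    cases Z Zs zero (suc (suc k)) = ≡.trans (planeVal-left true 2 1 Z Zs _ (s≤s (s≤s z≤n)))
      (≡.sym (planeVal-left true 1 0 Z Zs _ (s≤s z≤n)))
    cases Z Zs (suc j) k = planeVal-suc true 1 0 Z Zs (suc j) k

  staircaseN-lo : ∀ u p ps x j k →
    planeVal (staircase N u (p ∷ ps) x) (skip 1 j) (suc k) ≡ planeVal (staircase E (lo E p) ps x) j k
  staircaseN-lo u p ps x j k = tail-cons E ps x
    (λ Zs → planeVal (placeAll true 0 0 (domino N u) (block a p ∷ Zs)) (skip 1 j) (suc k)
      ≡ planeVal (placeAll false 0 0 (domino E (lo E p)) Zs) j k) (λ Z Zs → cases Z Zs j k)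
    where
    cases : ∀ Z Zs j k → planeVal (placeAll true 0 0 (domino N u) (block a p ∷ Z ∷ Zs)) (skip 1 j) (suc k)
      ≡ planeVal (placeAll false 0 0 (domino E (lo E p)) (Z ∷ Zs)) j k
    cases Z Zs zero zero = ≡.refl
    cases Z Zs zero (suc zero) = ≡.refl
    cases Z Zs zero (suc (suc k)) = ≡.trans (planeVal-left true 2 1 Z Zs _ (s≤s z≤n))
      (≡.sym (planeVal-left true 1 0 Z Zs _ (s≤s z≤n)))
    cases Z Zs (suc j) k = planeVal-suc true 1 0 Z Zs (suc j) k

  staircaseN-bottom : ∀ u p ps x j → planeVal (staircase N u (p ∷ ps) x) (suc (suc j)) 0 ≡ 0#
  staircaseN-bottom u p ps x j = planeVal-below false 0 1 (block a p) (tail E ps x) _ (s≤s z≤n)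

  -- The mirror image: the column of `u` and the bottom row of the block disappear, and the top row
  -- of the block becomes the new horizontal domino.
  staircaseE-hi : ∀ u p ps x j k →
    planeVal (staircase E u (p ∷ ps) x) (suc j) (suc k) ≡ planeVal (staircase N (hi N p) ps x) j k
  staircaseE-hi u p ps x j k = tail-cons N ps x
    (λ Zs → planeVal (placeAll false 0 0 (domino E u) (block a p ∷ Zs)) (suc j) (suc k)
      ≡ planeVal (placeAll true 0 0 (domino N (hi N p)) Zs) j k) (λ Z Zs → cases Z Zs j k)
    where
    cases : ∀ Z Zs j k → planeVal (placeAll false 0 0 (domino E u) (block a p ∷ Z ∷ Zs)) (suc j) (suc k)
      ≡ planeVal (placeAll true 0 0 (domino N (hi N p)) (Z ∷ Zs)) j k
    cases Z Zs zero zero = ≡.refl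
    cases Z Zs (suc zero) zero = ≡.refl
    cases Z Zs (suc (suc j)) zero = ≡.trans (planeVal-below false 1 2 Z Zs _ (s≤s (s≤s z≤n)))
      (≡.sym (planeVal-below false 0 1 Z Zs _ (s≤s z≤n)))
    cases Z Zs zero (suc k) = planeVal-suc false 0 1 Z Zs zero (suc k)
    cases Z Zs (suc zero) (suc k) = planeVal-suc false 0 1 Z Zs (suc zero) (suc k)
    cases Z Zs (suc (suc j)) (suc k) = planeVal-suc false 0 1 Z Zs (suc (suc j)) (suc k)

  staircaseE-lo : ∀ u p ps x j k →
    planeVal (staircase E u (p ∷ ps) x) (suc j) (skip 1 k) ≡ planeVal (staircase N (lo N p) ps x) j k
  staircaseE-lo u p ps x j k = tail-cons N ps x
    (λ Zs → planeVal (placeAll false 0 0 (domino E u) (block a p ∷ Zs)) (suc j) (skip 1 k)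
      ≡ planeVal (placeAll true 0 0 (domino N (lo N p)) Zs) j k) (λ Z Zs → cases Z Zs j k)
    where
    cases : ∀ Z Zs j k → planeVal (placeAll false 0 0 (domino E u) (block a p ∷ Z ∷ Zs)) (suc j) (skip 1 k)
      ≡ planeVal (placeAll true 0 0 (domino N (lo N p)) (Z ∷ Zs)) j k
    cases Z Zs zero zero = ≡.refl
    cases Z Zs (suc zero) zero = ≡.refl
    cases Z Zs (suc (suc j)) zero = ≡.trans (planeVal-below false 1 2 Z Zs _ (s≤s z≤n))
      (≡.sym (planeVal-below false 0 1 Z Zs _ (s≤s z≤n)))
    cases Z Zs zero (suc k) = planeVal-suc false 0 1 Z Zs zero (suc k)
    cases Z Zs (suc zero) (suc k) = planeVal-suc false 0 1 Z Zs (suc zero) (suc k)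
    cases Z Zs (suc (suc j)) (suc k) = planeVal-suc false 0 1 Z Zs (suc (suc j)) (suc k)

  staircaseE-left : ∀ u p ps x k → planeVal (staircase E u (p ∷ ps) x) 0 (suc (suc k)) ≡ 0#
  staircaseE-left u p ps x k = planeVal-left true 1 0 (block a p) (tail N ps x) _ (s≤s z≤n)

  -- The increment of the triangular exponent gives `sgn (suc m)` and the expansion gives
  -- `sgn (suc (suc m))`. Their product is -1 for every `m`, and it is used up by exchanging the two
  -- terms, as the definition of `ω` requires.
  signed-expansion : ∀ m u₁ u₂ y D₁ D₂ (l h : Vector) →
    sgn (triangle m) * D₁ ≈ ω h y → sgn (triangle m) * D₂ ≈ ω l y →
    sgn (triangle (suc m)) * (sgn (suc (suc m)) * (u₁ * D₁ - u₂ * D₂)) ≈ ω (u₁ , u₂) (ω l y , ω h y)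
  signed-expansion m u₁ u₂ y D₁ D₂ l h eq₁ eq₂ = begin
    sgn (triangle (suc m)) * (sgn (suc (suc m)) * (u₁ * D₁ - u₂ * D₂))
      ≈⟨ *-congʳ (sgn-triangle-suc m) ⟩
    sgn (triangle m) * s * (- s * (u₁ * D₁ - u₂ * D₂))
      ≈⟨ solve 6 (λ t s u v D F → t :* s :* (:- s :* (u :* D :- v :* F))
           := (s :* s) :* (v :* (t :* F) :- u :* (t :* D))) refl (sgn (triangle m)) s u₁ u₂ D₁ D₂ ⟩
    (s * s) * (u₂ * (sgn (triangle m) * D₂) - u₁ * (sgn (triangle m) * D₁))
      ≈⟨ *-cong (sgn-square (suc m)) (+-cong (*-congˡ eq₂) (-‿cong (*-congˡ eq₁))) ⟩
    1# * (u₂ * ω l y - u₁ * ω h y)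
      ≈⟨ *-identityˡ _ ⟩
    u₂ * ω l y - u₁ * ω h y ∎
    where
    open import Relation.Binary.Reasoning.Setoid setoid
    s = sgn (suc m)

  suc-∸ : ∀ {i m} → i < suc m → suc m ∸ i ≡ suc (m ∸ i)
  suc-∸ (s≤s i≤m) = ℕₚ.+-∸-assoc 1 i≤m

  -- Matrix rows are counted from the top and cells from the bottom: row `m` of `m + 2` rows has
  -- height 1.
  ∸-skip : ∀ {i} m → i < suc m → suc m ∸ skip m i ≡ skip 1 (m ∸ i)
  ∸-skip {zero} zero (s≤s z≤n) = ≡.refl
  ∸-skip {zero} (suc m) (s≤s z≤n) = ≡.refl
  ∸-skip {suc i} (suc m) (s≤s i<1+m) rewrite skip-suc m i = ∸-skip m i<1+m

  -- Induction on the blocks, with `u` arbitrary because the hypothesis is used for both edges `lo`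
  -- and `hi` of the first block. These two values are the components of a `transfer`, so the
  -- elimination acts on the far end `x` while `u` stays fixed.
  det-staircase : ∀ L u ps x →
    sgn (triangle (length ps)) *
      det (2 ℕ.+ length ps) (λ i j → planeVal (staircase L u ps x) j (suc (length ps) ∸ i))
    ≈ ω u (pull L ps x)
  det-staircase N (u₁ , u₂) [] (x₁ , x₂) = solve 4 (λ u v x y →
    con (+ 1) :* (con (+ 0) :+ con (+ 1) :* (x :* (con (+ 0) :+ con (+ 1) :* (v :* con (+ 1))))
      :+ :- con (+ 1) :* (y :* (con (+ 0) :+ con (+ 1) :* (u :* con (+ 1)))))
    := v :* x :- u :* y) refl u₁ u₂ x₁ x₂
  det-staircase E (u₁ , u₂) [] (x₁ , x₂) = solve 4 (λ u v x y →
    con (+ 1) :* (con (+ 0) :+ con (+ 1) :* (v :* (con (+ 0) :+ con (+ 1) :* (x :* con (+ 1))))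
      :+ :- con (+ 1) :* (y :* (con (+ 0) :+ con (+ 1) :* (u :* con (+ 1)))))
    := v :* x :- u :* y) refl u₁ u₂ x₁ x₂
  det-staircase N u@(u₁ , u₂) (p ∷ ps) x = trans (*-congˡ expansion)
    (signed-expansion n u₁ u₂ (pull E ps x) _ _ (lo E p) (hi E p)
      (det-staircase E (hi E p) ps x) (det-staircase E (lo E p) ps x))
    where
    n = length ps
    M : Matrix
    M i j = planeVal (staircase N u (p ∷ ps) x) j (suc (suc n) ∸ i)
    bottom : ∀ j → M (suc (suc n)) j ≡ planeVal (staircase N u (p ∷ ps) x) j 0
    bottom j = ≡.cong (planeVal (staircase N u (p ∷ ps) x) j) (ℕₚ.n∸n≡0 n)
    expansion : det (3 ℕ.+ n) M ≈ sgn (suc (suc n)) *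
      (u₁ * det (2 ℕ.+ n) (λ i j → planeVal (staircase E (hi E p) ps x) j (suc n ∸ i))
       - u₂ * det (2 ℕ.+ n) (λ i j → planeVal (staircase E (lo E p) ps x) j (suc n ∸ i)))
    expansion = trans
      (det-bottom-row-2 (suc n) M λ k _ →
        reflexive (≡.trans (bottom (suc (suc k))) (staircaseN-bottom u p ps x k)))
      (*-congˡ (+-cong
        (*-cong (reflexive (bottom 0)) (det-cong (2 ℕ.+ n) λ i j i< _ → reflexive (≡.trans
          (≡.cong (planeVal (staircase N u (p ∷ ps) x) (suc j)) (suc-∸ i<)) (staircaseN-hi u p ps x j (suc n ∸ i)))))
        (-‿cong (*-cong (reflexive (bottom 1)) (det-cong (2 ℕ.+ n) λ i j i< _ → reflexive (≡.trans
          (≡.cong (planeVal (staircase N u (p ∷ ps) x) (skip 1 j)) (suc-∸ i<)) (staircaseN-lo u p ps x j (suc n ∸ i))))))))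
  det-staircase E u@(u₁ , u₂) (p ∷ ps) x = trans (*-congˡ expansion)
    (signed-expansion n u₁ u₂ (pull N ps x) _ _ (lo N p) (hi N p)
      (det-staircase N (hi N p) ps x) (det-staircase N (lo N p) ps x))
    where
    n = length ps
    M : Matrix
    M i j = planeVal (staircase E u (p ∷ ps) x) j (suc (suc n) ∸ i)
    left : ∀ {k k′} → k ≡ k′ → planeVal (staircase E u (p ∷ ps) x) 0 k ≡ planeVal (staircase E u (p ∷ ps) x) 0 k′
    left = ≡.cong (planeVal (staircase E u (p ∷ ps) x) 0)
    expansion : det (3 ℕ.+ n) M ≈ sgn (suc (suc n)) *
      (u₁ * det (2 ℕ.+ n) (λ i j → planeVal (staircase N (hi N p) ps x) j (suc n ∸ i))
       - u₂ * det (2 ℕ.+ n) (λ i j → planeVal (staircase N (lo N p) ps x) j (suc n ∸ i)))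
    expansion = trans
      (det-left-column-2 (suc n) M λ i i<1+n → reflexive (≡.trans
        (left (≡.trans (suc-∸ (ℕₚ.m<n⇒m<1+n i<1+n)) (≡.cong suc (suc-∸ i<1+n))))
        (staircaseE-left u p ps x _)))
      (*-congˡ (+-cong
        (*-cong (reflexive (left (ℕₚ.n∸n≡0 n))) (det-cong (2 ℕ.+ n) λ i j i< _ → reflexive (≡.trans
          (≡.cong (planeVal (staircase E u (p ∷ ps) x) (suc j)) (suc-∸ i<)) (staircaseE-hi u p ps x j (suc n ∸ i)))))
        (-‿cong (*-cong (reflexive (left (ℕₚ.m+n∸n≡m 1 n))) (det-cong (2 ℕ.+ n) λ i j i< _ → reflexive (≡.trans
          (≡.cong (planeVal (staircase E u (p ∷ ps) x) (suc j)) (∸-skip (suc n) i<)) (staircaseE-lo u p ps x j (suc n ∸ i))))))))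

  ⊔-block : ∀ x d n → (x ℕ.+ 2) ⊔ (x ℕ.+ (2 ℕ.+ d) ℕ.+ n) ≡ x ℕ.+ (2 ℕ.+ d) ℕ.+ n
  ⊔-block x d n = ℕₚ.m≤n⇒m⊔n≡n (ℕₚ.≤-trans (ℕₚ.+-monoʳ-≤ x (ℕₚ.m≤m+n 2 d)) (ℕₚ.m≤m+n _ n))

  rearrange₃ : ∀ x n → x ℕ.+ 3 ℕ.+ n ≡ x ℕ.+ 2 ℕ.+ suc n
  rearrange₃ = solve-∀

  rearrange₄ : ∀ x n → x ℕ.+ 2 ℕ.+ 2 ℕ.+ n ≡ x ℕ.+ 3 ℕ.+ suc n
  rearrange₄ = solve-∀

  -- Horizontal moves alternate between 0 and 2. The width of the last domino evens this out, so
  -- every further block adds exactly one column.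
  blocks-width : ∀ L x y p ps z →
    drhWidth (placeAll (isN L) x y (block a p) (tail L ps z)) ≡ x ℕ.+ (if isN L then 2 else 3) ℕ.+ length ps
  blocks-width N x y p [] z = ≡.trans (≡.cong (x ℕ.+ 2 ⊔_) (ℕₚ.⊔-identityʳ _))
    (≡.trans (ℕₚ.⊔-idem (x ℕ.+ 2)) (≡.sym (ℕₚ.+-identityʳ _)))
  blocks-width E x y p [] z = ≡.trans
    (≡.cong (x ℕ.+ 2 ⊔_) (≡.trans (ℕₚ.⊔-identityʳ _) (≡.trans (ℕₚ.+-assoc x 2 1) (≡.sym (ℕₚ.+-identityʳ _)))))
    (⊔-block x 1 0)
  blocks-width N x y p (q ∷ ps) z = ≡.trans
    (≡.cong (x ℕ.+ 2 ⊔_) (≡.trans (blocks-width E x (y ℕ.+ 2) q ps z) (rearrange₃ x (length ps))))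
    (⊔-block x 0 (suc (length ps)))
  blocks-width E x y p (q ∷ ps) z = ≡.trans
    (≡.cong (x ℕ.+ 2 ⊔_) (≡.trans (blocks-width N (x ℕ.+ 2) y q ps z) (rearrange₄ x (length ps))))
    (⊔-block x 1 (suc (length ps)))

  blocks-height : ∀ L x y p ps z →
    drhHeight (placeAll (isN L) x y (block a p) (tail L ps z)) ≡ y ℕ.+ (if isN L then 3 else 2) ℕ.+ length ps
  blocks-height E x y p [] z = ≡.trans (≡.cong (y ℕ.+ 2 ⊔_) (ℕₚ.⊔-identityʳ _))
    (≡.trans (ℕₚ.⊔-idem (y ℕ.+ 2)) (≡.sym (ℕₚ.+-identityʳ _)))
  blocks-height N x y p [] z = ≡.trans
    (≡.cong (y ℕ.+ 2 ⊔_) (≡.trans (ℕₚ.⊔-identityʳ _) (≡.trans (ℕₚ.+-assoc y 2 1) (≡.sym (ℕₚ.+-identityʳ _)))))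
    (⊔-block y 1 0)
  blocks-height E x y p (q ∷ ps) z = ≡.trans
    (≡.cong (y ℕ.+ 2 ⊔_) (≡.trans (blocks-height N (x ℕ.+ 2) y q ps z) (rearrange₃ y (length ps))))
    (⊔-block y 0 (suc (length ps)))
  blocks-height N x y p (q ∷ ps) z = ≡.trans
    (≡.cong (y ℕ.+ 2 ⊔_) (≡.trans (blocks-height E x (y ℕ.+ 2) q ps z) (rearrange₄ y (length ps))))
    (⊔-block y 1 (suc (length ps)))

  staircase-width : ∀ L u ps x → drhWidth (staircase L u ps x) ≡ 2 ℕ.+ length ps
  staircase-width N u [] x = ≡.refl
  staircase-width E u [] x = ≡.refl
  staircase-width N u (p ∷ ps) x rewrite blocks-width E 0 1 p ps x = ≡.refl
  staircase-width E u (p ∷ ps) x rewrite blocks-width N 1 0 p ps x = ≡.refl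

  staircase-height : ∀ L u ps x → drhHeight (staircase L u ps x) ≡ 2 ℕ.+ length ps
  staircase-height N u [] x = ≡.refl
  staircase-height E u [] x = ≡.refl
  staircase-height N u (p ∷ ps) x rewrite blocks-height E 0 1 p ps x = ≡.refl
  staircase-height E u (p ∷ ps) x rewrite blocks-height N 1 0 p ps x = ≡.refl

  placeDRH-domino : ∀ L u Zs → placeDRH (domino L u) Zs ≡ placeAll (isN L) 0 0 (domino L u) Zs
  placeDRH-domino N u Zs = ≡.refl
  placeDRH-domino E u Zs = ≡.refl

  lo-domino : ∀ L p → (if isN L then hMinus a p else vMinus a p) ≡ domino L (lo L p)
  lo-domino N p = ≡.refl
  lo-domino E p = ≡.refl

  hi-domino : ∀ L p → (if isN L then hPlus a p else vPlus a p) ≡ domino L (hi L p)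
  hi-domino N p = ≡.refl
  hi-domino E p = ≡.refl

  stdPieces-staircase : ∀ w r s → lastLetter (letter w r) (map (P w) (bends w r s)) ≡ letter w s →
    stdPieces a w r s ≡
      staircase (letter w r) (lo (letter w r) (P w r)) (map (P w) (bends w r s)) (hi (letter w s) (P w (suc s)))
  stdPieces-staircase w r s last≡
    rewrite lo-domino (letter w r) (P w r) | hi-domino (letter w s) (P w (suc s))
          | Listₚ.map-∘ {g = block a} {f = P w} (bends w r s) | last≡
    = placeDRH-domino (letter w r) _ _

  -- `cc` as a function of the placed pieces alone, so that an equality of piece lists can be
  -- transported through the size and the matrix at once.
  signed-det : List (ℕ × ℕ × Piece) → Carrier
  signed-det Zs = sgn (((drhWidth Zs ∸ 1) ℕ.* (drhWidth Zs ∸ 2)) ℕ./ 2) * det (drhWidth Zs) (drhMatrix Zs)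

  signed-det-staircase : ∀ L u ps x → signed-det (staircase L u ps x) ≈ ω u (pull L ps x)
  signed-det-staircase L u ps x rewrite staircase-width L u ps x | staircase-height L u ps x =
    det-staircase L u ps x

  cc-pull : ∀ w r s → lastLetter (letter w r) (map (P w) (bends w r s)) ≡ letter w s →
    cc a w r s ≈
      ω (lo (letter w r) (P w r)) (pull (letter w r) (map (P w) (bends w r s)) (hi (letter w s) (P w (suc s))))
  cc-pull w r s last≡ = trans (reflexive (≡.cong signed-det (stdPieces-staircase w r s last≡)))
    (signed-det-staircase (letter w r) (lo (letter w r) (P w r)) (map (P w) (bends w r s)) (hi (letter w s) (P w (suc s))))

-- Occurrences of letters and adjacent entries of ρ and κ.

is : Letter → Letter → Bool
is N = isN
is E = isE

is-true : ∀ L M → is L M ≡ true → M ≡ L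
is-true N N _ = ≡.refl
is-true E E _ = ≡.refl

is-false : ∀ L M → is L M ≡ false → M ≡ other L
is-false N E _ = ≡.refl
is-false E N _ = ≡.refl

L≢other : ∀ {L} → L ≢ other L
L≢other {N} ()
L≢other {E} ()

interval-iterate : ∀ r s → interval r s ≡ iterate suc r (suc s ∸ r)
interval-iterate r s = ≡.trans (Listₚ.map-upTo _ (suc s ∸ r))
  (shifted (λ k → r ℕ.+ k) r (suc s ∸ r) (λ _ → ≡.refl))
  where
  shifted : ∀ f r n → (∀ k → f k ≡ r ℕ.+ k) → applyUpTo f n ≡ iterate suc r n
  shifted f r zero f≡ = ≡.refl
  shifted f r (suc n) f≡ = ≡.cong₂ _∷_ (≡.trans (f≡ 0) (ℕₚ.+-identityʳ r))
    (shifted (f ∘ suc) (suc r) n (λ k → ≡.trans (f≡ (suc k)) (ℕₚ.+-suc r k)))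

module _ {a} {A : Set a} where

  last-∷ʳ : ∀ (xs : List A) x → last (xs ∷ʳ x) ≡ just x
  last-∷ʳ [] x = ≡.refl
  last-∷ʳ (y ∷ []) x = ≡.refl
  last-∷ʳ (y ∷ z ∷ xs) x = last-∷ʳ (z ∷ xs) x

  last-reverse : ∀ (xs : List A) → last (reverse xs) ≡ head xs
  last-reverse [] = ≡.refl
  last-reverse (x ∷ xs) = ≡.trans (≡.cong last (Listₚ.unfold-reverse x xs)) (last-∷ʳ (reverse xs) x)

  head-reverse : ∀ (xs : List A) → head (reverse xs) ≡ last xs
  head-reverse xs = ≡.trans (≡.sym (last-reverse (reverse xs))) (≡.cong last (Listₚ.reverse-involutive xs))

  Linked-reverse : ∀ {r} {R : A → A → Set r} {xs} → Linked R xs → Linked (flip R) (reverse xs)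
  Linked-reverse [] = []
  Linked-reverse {R = R} {x ∷ xs} Rxs = ≡.subst (Linked (flip R)) (≡.sym (Listₚ.unfold-reverse x xs))
    (Linkedₚ.++⁺ (Linked-reverse (Linked.tail Rxs))
      (≡.subst (λ m → Connected (flip R) m (just x)) (≡.sym (last-reverse xs)) (Connected.sym (λ r → r) (head′ Rxs)))
      [-])

  connect : ∀ {r} {R : A → A → Set r} m n → (∀ {x y} → m ≡ just x → n ≡ just y → R x y) → Connected R m n
  connect (just x) (just y) Rxy = just (Rxy ≡.refl ≡.refl)
  connect (just x) nothing Rxy = just-nothing
  connect nothing (just y) Rxy = nothing-just
  connect nothing nothing Rxy = nothing

at-Linked : ∀ {r} {R : ℕ → ℕ → Set r} {xs} → Linked R xs →
  ∀ i → 1 ≤ i → suc i ≤ length xs → R (at xs i) (at xs (suc i))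
at-Linked [-] (suc i) _ (s≤s ())
at-Linked (Rxy ∷ Rxs) (suc zero) _ _ = Rxy
at-Linked (Rxy ∷ Rxs) (suc (suc i)) _ (s≤s i<) = at-Linked Rxs (suc i) (s≤s z≤n) i<

module Words (w : List Letter) where

  l : ℕ
  l = length w

  bend : ℕ → Bool
  bend k = not (letter w (k ∸ 1) =L letter w k)

  occurrences : Letter → List ℕ → List ℕ
  occurrences L = filterᵇ (λ k → is L (letter w k))

  record Next (L : Letter) (q p : ℕ) : Set where
    constructor next
    field
      positive : 1 ≤ q
      ordered : q < p
      bounded : p ≤ l
      leftLetter : letter w q ≡ L
      rightLetter : letter w p ≡ L
      between : ∀ k → q < k → k < p → letter w k ≡ other L

  -- The window from `j` to `j + n − 1` is the range of `iterate suc j n`, so `First` and `Last`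
  -- follow the recursion of that list.
  record First (L : Letter) (j n p : ℕ) : Set where
    constructor first
    field
      lower : j ≤ p
      upper : p < j ℕ.+ n
      here : letter w p ≡ L
      before : ∀ k → j ≤ k → k < p → letter w k ≡ other L

  record Last (L : Letter) (j n p : ℕ) : Set where
    constructor final
    field
      lower : j ≤ p
      upper : p < j ℕ.+ n
      here : letter w p ≡ L
      after : ∀ k → p < k → k < j ℕ.+ n → letter w k ≡ other L

  First-occurrence : ∀ L j n {p} → head (occurrences L (iterate suc j n)) ≡ just p → First L j n p
  First-occurrence L j (suc n) eq with is L (letter w j) in is≡
  First-occurrence L j (suc n) ≡.refl | true = first ℕₚ.≤-refl (ℕₚ.m<m+n j (s≤s z≤n)) (is-true L _ is≡)
    (λ k j≤k k<j → ⊥-elim (ℕₚ.<⇒≱ k<j j≤k))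
  First-occurrence L j (suc n) {p} eq | false with First-occurrence L (suc j) n eq
  ... | first j<p p< p≡L before = first (ℕₚ.<⇒≤ j<p) (≡.subst (p <_) (≡.sym (ℕₚ.+-suc j n)) p<) p≡L earlier
    where
    earlier : ∀ k → j ≤ k → k < p → letter w k ≡ other L
    earlier k j≤k k<p with ℕₚ.m≤n⇒m<n∨m≡n j≤k
    ... | inj₁ j<k = before k j<k k<p
    ... | inj₂ ≡.refl = is-false L _ is≡

  no-occurrence : ∀ L j n → occurrences L (iterate suc j n) ≡ [] →
    ∀ k → j ≤ k → k < j ℕ.+ n → letter w k ≡ other L
  no-occurrence L j zero eq k j≤k k<j = ⊥-elim (ℕₚ.<⇒≱ (≡.subst (k <_) (ℕₚ.+-identityʳ j) k<j) j≤k)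
  no-occurrence L j (suc n) eq k j≤k k< with is L (letter w j) in is≡
  no-occurrence L j (suc n) eq k j≤k k< | false with ℕₚ.m≤n⇒m<n∨m≡n j≤k
  ... | inj₁ j<k = no-occurrence L (suc j) n eq k j<k (≡.subst (k <_) (ℕₚ.+-suc j n) k<)
  ... | inj₂ ≡.refl = is-false L _ is≡

  Last-suc : ∀ {L j n p} → Last L (suc j) n p → Last L j (suc n) p
  Last-suc {L} {j} {n} {p} (final j<p p< p≡L after) = final (ℕₚ.<⇒≤ j<p)
    (≡.subst (p <_) (≡.sym (ℕₚ.+-suc j n)) p<) p≡L
    (λ k p<k k< → after k p<k (≡.subst (k <_) (ℕₚ.+-suc j n) k<))

  Last-occurrence : ∀ L j n {p} → last (occurrences L (iterate suc j n)) ≡ just p → Last L j n p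
  Last-occurrence L j (suc n) eq with is L (letter w j) in is≡
  Last-occurrence L j (suc n) eq | false = Last-suc (Last-occurrence L (suc j) n eq)
  Last-occurrence L j (suc n) eq | true with occurrences L (iterate suc (suc j) n) in occ≡
  Last-occurrence L j (suc n) ≡.refl | true | [] = final ℕₚ.≤-refl (ℕₚ.m<m+n j (s≤s z≤n)) (is-true L _ is≡)
    (λ k j<k k< → no-occurrence L (suc j) n occ≡ k j<k (≡.subst (k <_) (ℕₚ.+-suc j n) k<))
  Last-occurrence L j (suc n) eq | true | x ∷ xs =
    Last-suc (Last-occurrence L (suc j) n (≡.trans (≡.cong last occ≡) eq))

  Linked-occurrences : ∀ L j n → 1 ≤ j → j ℕ.+ n ≤ suc l → Linked (Next L) (occurrences L (iterate suc j n))
  Linked-occurrences L j zero 1≤j j+n≤ = []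
  Linked-occurrences L j (suc n) 1≤j j+n≤ with is L (letter w j) in is≡
  ... | false = Linked-occurrences L (suc j) n (s≤s z≤n) (≡.subst (_≤ suc l) (ℕₚ.+-suc j n) j+n≤)
  ... | true = connect (just j) _ adjacent ∷′ Linked-occurrences L (suc j) n (s≤s z≤n) j+n≤′
    where
    j+n≤′ : suc j ℕ.+ n ≤ suc l
    j+n≤′ = ≡.subst (_≤ suc l) (ℕₚ.+-suc j n) j+n≤
    adjacent : ∀ {q p} → just j ≡ just q → head (occurrences L (iterate suc (suc j) n)) ≡ just p → Next L q p
    adjacent ≡.refl eq with First-occurrence L (suc j) n eq
    ... | first j<p p< p≡L before =
      next 1≤j j<p (ℕₚ.≤-pred (ℕₚ.≤-trans p< j+n≤′)) (is-true L _ is≡) p≡L before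

  -- `ρ` runs down the E-indices and then up the N-indices, so it changes letter where both lists
  -- are at their smallest element. In `κ` the change happens at the two largest elements.
  data RowAdjacent (x y : ℕ) : Set where
    east : Next E y x → RowAdjacent x y
    north : Next N x y → RowAdjacent x y
    turning : First E 1 l x → First N 1 l y → RowAdjacent x y

  data ColumnAdjacent (x y : ℕ) : Set where
    east : Next E x y → ColumnAdjacent x y
    north : Next N y x → ColumnAdjacent x y
    turning : Last E 1 l x → Last N 1 l y → ColumnAdjacent x y

  eIdx-occurrences : eIdx w ≡ occurrences E (iterate suc 1 l)
  eIdx-occurrences = ≡.cong (occurrences E) (interval-iterate 1 l)

  nIdx-occurrences : nIdx w ≡ occurrences N (iterate suc 1 l)
  nIdx-occurrences = ≡.cong (occurrences N) (interval-iterate 1 l)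

  length-occurrences : ∀ ks → length (occurrences E ks) ℕ.+ length (occurrences N ks) ≡ length ks
  length-occurrences [] = ≡.refl
  length-occurrences (k ∷ ks) with letter w k
  ... | E = ≡.cong suc (length-occurrences ks)
  ... | N = ≡.trans (ℕₚ.+-suc _ _) (≡.cong suc (length-occurrences ks))

  length-indices : length (eIdx w) ℕ.+ length (nIdx w) ≡ l
  length-indices = ≡.trans (length-occurrences (interval 1 l))
    (≡.trans (≡.cong length (interval-iterate 1 l)) (Listₚ.length-iterate suc 1 l))

  Linked-eIdx : Linked (Next E) (eIdx w)
  Linked-eIdx = ≡.subst (Linked (Next E)) (≡.sym eIdx-occurrences) (Linked-occurrences E 1 l ℕₚ.≤-refl ℕₚ.≤-refl)

  Linked-nIdx : Linked (Next N) (nIdx w)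
  Linked-nIdx = ≡.subst (Linked (Next N)) (≡.sym nIdx-occurrences) (Linked-occurrences N 1 l ℕₚ.≤-refl ℕₚ.≤-refl)

  Linked-ρ : Linked RowAdjacent (reverse (eIdx w) ++ nIdx w)
  Linked-ρ = Linkedₚ.++⁺ (Linked.map east (Linked-reverse Linked-eIdx))
    (connect _ _ λ last≡ head≡ → turning
      (First-occurrence E 1 l (≡.trans (≡.cong head (≡.sym eIdx-occurrences)) (≡.trans (≡.sym (last-reverse (eIdx w))) last≡)))
      (First-occurrence N 1 l (≡.trans (≡.cong head (≡.sym nIdx-occurrences)) head≡)))
    (Linked.map north Linked-nIdx)

  Linked-κ : Linked ColumnAdjacent (eIdx w ++ reverse (nIdx w))
  Linked-κ = Linkedₚ.++⁺ (Linked.map east Linked-eIdx)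
    (connect _ _ λ last≡ head≡ → turning
      (Last-occurrence E 1 l (≡.trans (≡.cong last (≡.sym eIdx-occurrences)) last≡))
      (Last-occurrence N 1 l (≡.trans (≡.cong last (≡.sym nIdx-occurrences)) (≡.trans (≡.sym (head-reverse (nIdx w))) head≡))))
    (Linked.map north (Linked-reverse Linked-nIdx))

  -- The bound `1 ≤ i` excludes the case in which `l ∸ 1` is truncated.
  suc≤l : ∀ {i} → 1 ≤ i → i ≤ l ∸ 1 → suc i ≤ l
  suc≤l (s≤s z≤n) i≤ = helper l i≤
    where
    helper : ∀ n {i} → suc i ≤ n ∸ 1 → suc (suc i) ≤ n
    helper (suc n) i≤ = s≤s i≤

  ρ-adjacent : ∀ i → 1 ≤ i → i ≤ l ∸ 1 → RowAdjacent (ρ w i) (ρ w (suc i))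
  ρ-adjacent i 1≤i i≤ = at-Linked Linked-ρ i 1≤i (≡.subst (suc i ≤_) (≡.sym total) (suc≤l 1≤i i≤))
    where
    total : length (reverse (eIdx w) ++ nIdx w) ≡ l
    total = ≡.trans (Listₚ.length-++ (reverse (eIdx w)))
      (≡.trans (≡.cong (ℕ._+ length (nIdx w)) (Listₚ.length-reverse (eIdx w))) length-indices)

  κ-adjacent : ∀ i → 1 ≤ i → i ≤ l ∸ 1 → ColumnAdjacent (κ w i) (κ w (suc i))
  κ-adjacent i 1≤i i≤ = at-Linked Linked-κ i 1≤i (≡.subst (suc i ≤_) (≡.sym total) (suc≤l 1≤i i≤))
    where
    total : length (eIdx w ++ reverse (nIdx w)) ≡ l
    total = ≡.trans (Listₚ.length-++ (eIdx w))
      (≡.trans (≡.cong (length (eIdx w) ℕ.+_) (Listₚ.length-reverse (nIdx w))) length-indices)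

  bends-iterate : ∀ r s → bends w r s ≡ filterᵇ bend (iterate suc (suc r) (s ∸ r))
  bends-iterate r s = ≡.cong (filterᵇ bend) (interval-iterate (suc r) s)

  iterate-suc-∷ʳ : ∀ j n → iterate suc j (suc n) ≡ iterate suc j n ∷ʳ (j ℕ.+ n)
  iterate-suc-∷ʳ j zero = ≡.cong (_∷ []) (≡.sym (ℕₚ.+-identityʳ j))
  iterate-suc-∷ʳ j (suc n) = ≡.cong (j ∷_)
    (≡.trans (iterate-suc-∷ʳ (suc j) n) (≡.cong (iterate suc (suc j) n ∷ʳ_) (≡.sym (ℕₚ.+-suc j n))))

  P-suc : ∀ {k} → 1 ≤ k → P w (suc k) ≡ step (letter w k) (P w k)
  P-suc {suc k} _ = ≡.refl

  length-occurrences-∷ʳ : ∀ L ks k →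
    length (occurrences L (ks ∷ʳ k)) ≡ (if is L (letter w k) then 1 else 0) ℕ.+ length (occurrences L ks)
  length-occurrences-∷ʳ L [] k with is L (letter w k)
  ... | true = ≡.refl
  ... | false = ≡.refl
  length-occurrences-∷ʳ L (j ∷ ks) k with is L (letter w j)
  ... | true = ≡.trans (≡.cong suc (length-occurrences-∷ʳ L ks k)) (≡.sym (ℕₚ.+-suc _ _))
  ... | false = length-occurrences-∷ʳ L ks k

  count : Letter → ℕ → ℕ
  count L k = length (occurrences L (iterate suc 1 k))

  count-suc : ∀ L k → count L (suc k) ≡ (if is L (letter w (suc k)) then 1 else 0) ℕ.+ count L k
  count-suc L k = ≡.trans (≡.cong (length ∘ occurrences L) (iterate-suc-∷ʳ 1 k))
    (length-occurrences-∷ʳ L (iterate suc 1 k) (suc k))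

  step-counts : ∀ M x y → step M (suc x , suc y) ≡
    (suc ((if isE M then 1 else 0) ℕ.+ x) , suc ((if isN M then 1 else 0) ℕ.+ y))
  step-counts N x y = ≡.refl
  step-counts E x y = ≡.refl

  P-counts : ∀ k → P w (suc k) ≡ (suc (count E k) , suc (count N k))
  P-counts zero = ≡.refl
  P-counts (suc k) = ≡.trans (≡.cong (step (letter w (suc k))) (P-counts k))
    (≡.trans (step-counts (letter w (suc k)) (count E k) (count N k))
      (≡.sym (≡.cong₂ (λ x y → suc x , suc y) (count-suc E k) (count-suc N k))))

  -- The last lattice point is (p-1, q-1), so the top right entry of its block is a_pq.
  P-end : P w (suc l) ≡ (suc (length (eIdx w)) , suc (length (nIdx w)))
  P-end = ≡.trans (P-counts l) (≡.sym (≡.cong₂ (λ xs ys → suc (length xs) , suc (length ys)) eIdx-occurrences nIdx-occurrences))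

  bend-false : ∀ L {k} → letter w k ≡ L → letter w (suc k) ≡ L → bend (suc k) ≡ false
  bend-false N eq₁ eq₂ rewrite eq₁ | eq₂ = ≡.refl
  bend-false E eq₁ eq₂ rewrite eq₁ | eq₂ = ≡.refl

  bend-true : ∀ L {k} → letter w k ≡ other L → letter w (suc k) ≡ L → bend (suc k) ≡ true
  bend-true N eq₁ eq₂ rewrite eq₁ | eq₂ = ≡.refl
  bend-true E eq₁ eq₂ rewrite eq₁ | eq₂ = ≡.refl

  data Bend (k : ℕ) : Set where
    straight : bend (suc k) ≡ false → letter w (suc k) ≡ letter w k → Bend k
    bent : bend (suc k) ≡ true → letter w (suc k) ≡ other (letter w k) → Bend k

  bend? : ∀ k → Bend k
  bend? k = helper (letter w k) (letter w (suc k)) ≡.refl ≡.refl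
    where
    helper : ∀ L M → letter w k ≡ L → letter w (suc k) ≡ M → Bend k
    helper N N eq₁ eq₂ = straight (bend-false N eq₁ eq₂) (≡.trans eq₂ (≡.sym eq₁))
    helper E E eq₁ eq₂ = straight (bend-false E eq₁ eq₂) (≡.trans eq₂ (≡.sym eq₁))
    helper N E eq₁ eq₂ = bent (bend-true E eq₁ eq₂) (≡.trans eq₂ (≡.cong other (≡.sym eq₁)))
    helper E N eq₁ eq₂ = bent (bend-true N eq₁ eq₂) (≡.trans eq₂ (≡.cong other (≡.sym eq₁)))

  ≡ᵇ-refl : ∀ k → (k ≡ᵇ k) ≡ true
  ≡ᵇ-refl zero = ≡.refl
  ≡ᵇ-refl (suc k) = ≡ᵇ-refl k

  ≡ᵇ-≢ : ∀ {m n} → m ≢ n → (m ≡ᵇ n) ≡ false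
  ≡ᵇ-≢ {zero} {zero} m≢n = ⊥-elim (m≢n ≡.refl)
  ≡ᵇ-≢ {zero} {suc n} m≢n = ≡.refl
  ≡ᵇ-≢ {suc m} {zero} m≢n = ≡.refl
  ≡ᵇ-≢ {suc m} {suc n} m≢n = ≡ᵇ-≢ (m≢n ∘ ≡.cong suc)

  elemᵇ-outside : ∀ k f j n → k < j → elemᵇ k (filterᵇ f (iterate suc j n)) ≡ false
  elemᵇ-outside k f j zero k<j = ≡.refl
  elemᵇ-outside k f j (suc n) k<j with f j
  ... | false = elemᵇ-outside k f (suc j) n (ℕₚ.m<n⇒m<1+n k<j)
  ... | true rewrite ≡ᵇ-≢ (ℕₚ.<⇒≢ k<j) = elemᵇ-outside k f (suc j) n (ℕₚ.m<n⇒m<1+n k<j)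

  elemᵇ-filter : ∀ k f j n → j ≤ k → k < j ℕ.+ n → elemᵇ k (filterᵇ f (iterate suc j n)) ≡ f k
  elemᵇ-filter k f j zero j≤k k<j = ⊥-elim (ℕₚ.<⇒≱ (≡.subst (k <_) (ℕₚ.+-identityʳ j) k<j) j≤k)
  elemᵇ-filter k f j (suc n) j≤k k< with ℕₚ.m≤n⇒m<n∨m≡n j≤k
  elemᵇ-filter k f j (suc n) j≤k k< | inj₁ j<k with f j
  ... | false = elemᵇ-filter k f (suc j) n j<k (≡.subst (k <_) (ℕₚ.+-suc j n) k<)
  ... | true rewrite ≡ᵇ-≢ (ℕₚ.>⇒≢ j<k) = elemᵇ-filter k f (suc j) n j<k (≡.subst (k <_) (ℕₚ.+-suc j n) k<)
  elemᵇ-filter k f k (suc n) j≤k k< | inj₂ ≡.refl with f k in fk≡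
  ... | true rewrite ≡ᵇ-refl k = ≡.refl
  ... | false = elemᵇ-outside k f (suc k) n ℕₚ.≤-refl

  elemᵇ-bends : ∀ {k r s} → r < k → k ≤ s → elemᵇ k (bends w r s) ≡ bend k
  elemᵇ-bends {k} {r} {s} r<k k≤s rewrite bends-iterate r s = elemᵇ-filter k bend (suc r) (s ∸ r) r<k
    (≡.subst (k <_) (≡.cong suc (≡.sym (ℕₚ.m+[n∸m]≡n (ℕₚ.≤-trans (ℕₚ.<⇒≤ r<k) k≤s)))) (s≤s k≤s))

other-involutive : ∀ L → other (other L) ≡ L
other-involutive N = ≡.refl
other-involutive E = ≡.refl

-- Transport along the word and the boundary determinants.

module Pulling {c ℓ} (R : CommutativeRing c ℓ) (a : ℤ → ℤ → CommutativeRing.Carrier R) (w : List Letter) where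
  open CommutativeRing R hiding (zero)
  open WithRing R
  open IntegerCoefficients R using (solve; _:=_; con; _:+_; _:*_; :-_; _:-_)
  open Staircases R a
  open Words w
  open import Relation.Binary.Reasoning.Setoid setoid

  det₂ : Vector → Vector → Carrier
  det₂ (y₁ , y₂) (z₁ , z₂) = y₁ * z₂ - y₂ * z₁

  blockDet : ℕ × ℕ → Carrier
  blockDet (x , y) = A a x (suc y) * A a (suc x) y - A a (suc x) (suc y) * A a x y

  -- Blocks at consecutive lattice points overlap in a row or a column.
  lo-step : ∀ L p → lo L (step L p) ≡ hi L p
  lo-step N p = ≡.refl
  lo-step E p = ≡.refl

  -- The functionals `ω (lo L p)` and `ω (hi L p)` are the rows of T_k. Its determinant has the same
  -- sign for both letters, because transposing the block exchanges only its off-diagonal corners.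
  ω-lo-hi : ∀ L p y z →
    ω (lo L p) y * ω (hi L p) z - ω (lo L p) z * ω (hi L p) y ≈ - (blockDet p * det₂ y z)
  ω-lo-hi N p y z = solve 8 (λ bl br tl tr y₁ y₂ z₁ z₂ →
      (br :* y₁ :- bl :* y₂) :* (tr :* z₁ :- tl :* z₂) :- (br :* z₁ :- bl :* z₂) :* (tr :* y₁ :- tl :* y₂)
      := :- ((tl :* br :- tr :* bl) :* (y₁ :* z₂ :- y₂ :* z₁)))
    refl _ _ _ _ _ _ _ _
  ω-lo-hi E p y z = solve 8 (λ bl br tl tr y₁ y₂ z₁ z₂ →
      (tl :* y₁ :- bl :* y₂) :* (tr :* z₁ :- br :* z₂) :- (tl :* z₁ :- bl :* z₂) :* (tr :* y₁ :- br :* y₂)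
      := :- ((tl :* br :- tr :* bl) :* (y₁ :* z₂ :- y₂ :* z₁)))
    refl _ _ _ _ _ _ _ _

  ω-hi-lo : ∀ L p y z →
    ω (hi L p) y * ω (lo L p) z - ω (hi L p) z * ω (lo L p) y ≈ blockDet p * det₂ y z
  ω-hi-lo L p y z = trans
    (solve 4 (λ α β γ δ → α :* δ :- β :* γ := :- (γ :* β :- δ :* α)) refl _ _ _ _)
    (trans (-‿cong (ω-lo-hi L p y z)) (solve 1 (λ t → :- (:- t) := t) refl _))

  -- A multiple of the first row may be removed from the second; what remains is -t times the
  -- determinant in `ω-lo-hi`.
  ω-lo-combination : ∀ L p s t y z →
    ω (lo L p) y * (s * ω (lo L p) z - t * ω (hi L p) z) - ω (lo L p) z * (s * ω (lo L p) y - t * ω (hi L p) y)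
      ≈ (t * blockDet p) * det₂ y z
  ω-lo-combination L p s t y z = trans
    (solve 6 (λ s t α β γ δ → α :* (s :* β :- t :* δ) :- β :* (s :* α :- t :* γ) := :- (t :* (α :* δ :- β :* γ)))
      refl s t (ω (lo L p) y) (ω (lo L p) z) (ω (hi L p) y) (ω (hi L p) z))
    (trans (-‿cong (*-congˡ (ω-lo-hi L p y z)))
      (solve 3 (λ t b d → :- (t :* :- (b :* d)) := (t :* b) :* d) refl _ _ _))

  -- Takes the place of `s` in `ω-lo-combination`, where it cancels.
  turning-coefficient : Letter → ℕ × ℕ → Carrier
  turning-coefficient L p =
    proj₂ (lo L p) * proj₂ (lo (other L) (step L p)) - proj₁ (lo L p) * proj₂ (hi (other L) (step L p))

  -- The first entries of the two edges at the next block form the overlap `hi L p`. Hence the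
  -- coefficient of `proj₂ v` is, up to sign, `ω (lo L p) (hi L p)`, the determinant of the block.
  ω-lo-transfer : ∀ L p v →
    ω (lo L p) (transfer (other L) (step L p) v) ≈ turning-coefficient L p * proj₁ v - blockDet p * proj₂ v
  ω-lo-transfer N p v = solve 8 (λ bl br tl tr ttl ttr v₁ v₂ →
      br :* (ttl :* v₁ :- tl :* v₂) :- bl :* (ttr :* v₁ :- tr :* v₂)
      := (br :* ttl :- bl :* ttr) :* v₁ :- (tl :* br :- tr :* bl) :* v₂)
    refl _ _ _ _ _ _ _ _
  ω-lo-transfer E p v = solve 8 (λ bl br tl tr brr trr v₁ v₂ →
      tl :* (brr :* v₁ :- br :* v₂) :- bl :* (trr :* v₁ :- tr :* v₂)
      := (tl :* brr :- bl :* trr) :* v₁ :- (tl :* br :- tr :* bl) :* v₂)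
    refl _ _ _ _ _ _ _ _

  -- Transfer by the perpendicular edges of the block gives `proj₁ v` times `hi L p` minus `proj₂ v`
  -- times `lo L p`; the determinant with `hi L p` keeps only the second term.
  det₂-transfer-hi : ∀ L p v → det₂ (transfer (other L) p v) (hi L p) ≈ proj₂ v * blockDet p
  det₂-transfer-hi N p v = solve 6 (λ bl br tl tr v₁ v₂ →
      (tl :* v₁ :- bl :* v₂) :* tr :- (tr :* v₁ :- br :* v₂) :* tl := v₂ :* (tl :* br :- tr :* bl))
    refl _ _ _ _ _ _
  det₂-transfer-hi E p v = solve 6 (λ bl br tl tr v₁ v₂ →
      (br :* v₁ :- bl :* v₂) :* tr :- (tr :* v₁ :- tl :* v₂) :* br := v₂ :* (tl :* br :- tr :* bl))
    refl _ _ _ _ _ _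

  ω-hi-hi : ∀ L p → ω (hi L p) (hi L (step L p)) ≈ blockDet (step L p)
  ω-hi-hi N p = solve 4 (λ bl br tl tr → br :* tl :- bl :* tr := tl :* br :- tr :* bl) refl _ _ _ _
  ω-hi-hi E p = solve 4 (λ bl br tl tr → tl :* br :- bl :* tr := tl :* br :- tr :* bl) refl _ _ _ _

  det₂-hi-lo : ∀ L p → det₂ (hi L p) (lo L p) ≈ blockDet p
  det₂-hi-lo N p = solve 4 (λ bl br tl tr → tl :* br :- tr :* bl := tl :* br :- tr :* bl) refl _ _ _ _
  det₂-hi-lo E p = solve 4 (λ bl br tl tr → br :* tl :- tr :* bl := tl :* br :- tr :* bl) refl _ _ _ _

  turn : ℕ → Vector → Vector
  turn k y = if bend k then transfer (letter w k) (P w k) y else y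

  turn-straight : ∀ L {k} y → letter w k ≡ L → letter w (suc k) ≡ L → turn (suc k) y ≡ y
  turn-straight L y eq₁ eq₂ rewrite bend-false L eq₁ eq₂ = ≡.refl

  turn-bent : ∀ L {k} y → letter w k ≡ other L → letter w (suc k) ≡ L → turn (suc k) y ≡ transfer L (P w (suc k)) y
  turn-bent L y eq₁ eq₂ rewrite bend-true L eq₁ eq₂ = ≡.cong (λ M → transfer M _ y) eq₂

  pullRun : ℕ → ℕ → Vector → Vector
  pullRun k zero y = y
  pullRun k (suc n) y = turn (suc k) (pullRun (suc k) n y)

  bendsFrom : ℕ → ℕ → List ℕ
  bendsFrom k n = filterᵇ bend (iterate suc (suc k) n)

  -- `pull` switches letters at each listed point, and the word switches letters exactly at its
  -- bends, so the two stay in step.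
  pull-bendsFrom : ∀ k n y → pull (letter w k) (map (P w) (bendsFrom k n)) y ≡ pullRun k n y
  pull-bendsFrom k zero y = ≡.refl
  pull-bendsFrom k (suc n) y with bend? k
  ... | straight bend≡ letter≡ rewrite bend≡ =
    ≡.subst (λ L → pull L (map (P w) (bendsFrom (suc k) n)) y ≡ pullRun (suc k) n y) letter≡ (pull-bendsFrom (suc k) n y)
  ... | bent bend≡ letter≡ rewrite bend≡ = ≡.trans
    (≡.cong (λ L → transfer L (P w (suc k)) (pull L (map (P w) (bendsFrom (suc k) n)) y)) (≡.sym letter≡))
    (≡.cong (transfer (letter w (suc k)) (P w (suc k))) (pull-bendsFrom (suc k) n y))

  lastLetter-bendsFrom : ∀ k n → lastLetter (letter w k) (map (P w) (bendsFrom k n)) ≡ letter w (k ℕ.+ n)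
  lastLetter-bendsFrom k zero = ≡.cong (letter w) (≡.sym (ℕₚ.+-identityʳ k))
  lastLetter-bendsFrom k (suc n) with bend? k
  ... | straight bend≡ letter≡ rewrite bend≡ | ℕₚ.+-suc k n =
    ≡.subst (λ L → lastLetter L (map (P w) (bendsFrom (suc k) n)) ≡ letter w (suc k ℕ.+ n)) letter≡ (lastLetter-bendsFrom (suc k) n)
  ... | bent bend≡ letter≡ rewrite bend≡ | ℕₚ.+-suc k n =
    ≡.subst (λ L → lastLetter L (map (P w) (bendsFrom (suc k) n)) ≡ letter w (suc k ℕ.+ n)) letter≡ (lastLetter-bendsFrom (suc k) n)

  pullRun-suc : ∀ k n y → pullRun k (suc n) y ≡ pullRun k n (turn (suc (k ℕ.+ n)) y)
  pullRun-suc k zero y rewrite ℕₚ.+-identityʳ k = ≡.refl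
  pullRun-suc k (suc n) y rewrite ℕₚ.+-suc k n = ≡.cong (turn (suc k)) (pullRun-suc (suc k) n y)

  pullRun-+ : ∀ k m n y → pullRun k (m ℕ.+ n) y ≡ pullRun k m (pullRun (k ℕ.+ m) n y)
  pullRun-+ k zero n y rewrite ℕₚ.+-identityʳ k = ≡.refl
  pullRun-+ k (suc m) n y rewrite ℕₚ.+-suc k m = ≡.cong (turn (suc k)) (pullRun-+ (suc k) m n y)

  pullRun-constant : ∀ L k n y → (∀ i → k ≤ i → i ≤ k ℕ.+ n → letter w i ≡ L) → pullRun k n y ≡ y
  pullRun-constant L k zero y letters = ≡.refl
  pullRun-constant L k (suc n) y letters = ≡.trans
    (turn-straight L _ (letters k ℕₚ.≤-refl (ℕₚ.m≤m+n k (suc n)))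
      (letters (suc k) (ℕₚ.n≤1+n k) (ℕₚ.m<m+n k (s≤s z≤n))))
    (pullRun-constant L (suc k) n y
      (λ i k<i i≤ → letters i (ℕₚ.<⇒≤ k<i) (≡.subst (i ≤_) (≡.sym (ℕₚ.+-suc k n)) i≤)))

  pullTo : ℕ → ℕ → Vector → Vector
  pullTo r s = pullRun r (s ∸ r)

  pullTo-trans : ∀ {r s t} → r ≤ s → s ≤ t → ∀ y → pullTo r t y ≡ pullTo r s (pullTo s t y)
  pullTo-trans {r} {s} {t} r≤s s≤t y = ≡.trans
    (≡.cong (λ n → pullRun r n y) (≡.trans (≡.cong (_∸ r) (≡.sym (ℕₚ.m+[n∸m]≡n s≤t))) (ℕₚ.+-∸-comm (t ∸ s) r≤s)))
    (≡.trans (pullRun-+ r (s ∸ r) (t ∸ s) y)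
      (≡.cong (λ k → pullRun r (s ∸ r) (pullRun k (t ∸ s) y)) (ℕₚ.m+[n∸m]≡n r≤s)))

  pullTo-suc : ∀ k y → pullTo k (suc k) y ≡ turn (suc k) y
  pullTo-suc k y rewrite ℕₚ.m+n∸n≡m 1 k = ≡.refl

  pullTo-constant : ∀ L {r s} y → r ≤ s → (∀ i → r ≤ i → i ≤ s → letter w i ≡ L) → pullTo r s y ≡ y
  pullTo-constant L {r} {s} y r≤s letters = pullRun-constant L r (s ∸ r) y
    (λ i r≤i i≤ → letters i r≤i (≡.subst (i ≤_) (ℕₚ.m+[n∸m]≡n r≤s) i≤))

  pullTo-bend-first : ∀ L {r s} y → r < s → letter w r ≡ L → (∀ i → r < i → i ≤ s → letter w i ≡ other L) →
    pullTo r s y ≡ transfer (other L) (P w (suc r)) y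
  pullTo-bend-first L {r} y r<s eq after = ≡.trans (pullTo-trans (ℕₚ.n≤1+n r) r<s y)
    (≡.trans (pullTo-suc r _)
      (≡.trans (turn-bent (other L) _ (≡.trans eq (≡.sym (other-involutive L))) (after (suc r) ℕₚ.≤-refl r<s))
        (≡.cong (transfer (other L) (P w (suc r))) (pullTo-constant (other L) y r<s after))))

  pullTo-bend-last : ∀ L {r s} y → r ≤ s → (∀ i → r ≤ i → i ≤ s → letter w i ≡ other L) → letter w (suc s) ≡ L →
    pullTo r (suc s) y ≡ transfer L (P w (suc s)) y
  pullTo-bend-last L {r} {s} y r≤s before eq = ≡.trans (pullTo-trans r≤s (ℕₚ.n≤1+n s) y)
    (≡.trans (pullTo-constant (other L) _ r≤s before)
      (≡.trans (pullTo-suc s y) (turn-bent L y (before s r≤s ℕₚ.≤-refl) eq)))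

  pullTo-gap : ∀ L {r s} y → r < s → letter w r ≡ L → (∀ i → r < i → i ≤ s → letter w i ≡ other L) →
    letter w (suc s) ≡ L →
    pullTo r (suc s) y ≡ transfer (other L) (P w (suc r)) (transfer L (P w (suc s)) y)
  pullTo-gap L {r} {s} y r<s eq₁ between eq₂ = ≡.trans (pullTo-trans (ℕₚ.<⇒≤ r<s) (ℕₚ.n≤1+n s) y)
    (≡.trans (pullTo-bend-first L _ r<s eq₁ between)
      (≡.cong (transfer (other L) (P w (suc r)))
        (≡.trans (pullTo-suc s y) (turn-bent L y (between s r<s ℕₚ.≤-refl) eq₂))))

  source target : ℕ → Vector
  source r = lo (letter w r) (P w r)
  target s = hi (letter w s) (P w (suc s))

  cc-pullTo : ∀ {r s} → r ≤ s → cc a w r s ≈ ω (source r) (pullTo r s (target s))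
  cc-pullTo {r} {s} r≤s = trans
    (cc-pull w r s (≡.trans (≡.cong (λ ks → lastLetter (letter w r) (map (P w) ks)) (bends-iterate r s))
      (≡.trans (lastLetter-bendsFrom r (s ∸ r)) (≡.cong (letter w) (ℕₚ.m+[n∸m]≡n r≤s)))))
    (reflexive (≡.cong (ω (source r)) (≡.trans
      (≡.cong (λ ks → pull (letter w r) (map (P w) ks) (target s)) (bends-iterate r s))
      (pull-bendsFrom r (s ∸ r) (target s)))))

  -- The two signs absorb the sign −1 by which a transfer changes det₂.
  orientation : Letter → Carrier
  orientation N = 1#
  orientation E = - 1#

  det₂-transfer : ∀ L p y z → orientation (other L) * det₂ (transfer L p y) (transfer L p z)
    ≈ blockDet p * (orientation L * det₂ y z)
  det₂-transfer N p y z = trans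
    (*-congˡ (trans (solve 4 (λ α β γ δ → α :* δ :- γ :* β := α :* δ :- β :* γ) refl _ _ _ _) (ω-lo-hi N p y z)))
    (solve 2 (λ b d → :- con (+ 1) :* :- (b :* d) := b :* (con (+ 1) :* d)) refl _ _)
  det₂-transfer E p y z = trans
    (*-congˡ (trans (solve 4 (λ α β γ δ → α :* δ :- γ :* β := α :* δ :- β :* γ) refl _ _ _ _) (ω-lo-hi E p y z)))
    (solve 2 (λ b d → con (+ 1) :* :- (b :* d) := b :* (:- con (+ 1) :* d)) refl _ _)

  productOver : (ℕ → Carrier) → List ℕ → Carrier
  productOver g ks = foldr _*_ 1# (map g ks)

  -- The letters alternate from bend to bend, so the signs telescope and only the orientations at
  -- the two ends remain.
  det₂-pullRun : ∀ k n y z → orientation (letter w k) * det₂ (pullRun k n y) (pullRun k n z)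
    ≈ productOver (Δ a w) (bendsFrom k n) * (orientation (letter w (k ℕ.+ n)) * det₂ y z)
  det₂-pullRun k zero y z rewrite ℕₚ.+-identityʳ k = sym (*-identityˡ _)
  det₂-pullRun k (suc n) y z with bend? k
  ... | straight bend≡ letter≡ rewrite bend≡ | ℕₚ.+-suc k n =
    trans (*-congʳ (reflexive (≡.cong orientation (≡.sym letter≡)))) (det₂-pullRun (suc k) n y z)
  ... | bent bend≡ letter≡ rewrite bend≡ | ℕₚ.+-suc k n = begin
    orientation (letter w k) * det₂ (transfer L p (pullRun (suc k) n y)) (transfer L p (pullRun (suc k) n z))
      ≈⟨ *-congʳ (reflexive (≡.cong orientation (≡.trans (≡.sym (other-involutive (letter w k))) (≡.cong other (≡.sym letter≡))))) ⟩
    orientation (other L) * det₂ (transfer L p (pullRun (suc k) n y)) (transfer L p (pullRun (suc k) n z))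
      ≈⟨ det₂-transfer L p _ _ ⟩
    blockDet p * (orientation L * det₂ (pullRun (suc k) n y) (pullRun (suc k) n z))
      ≈⟨ *-congˡ (det₂-pullRun (suc k) n y z) ⟩
    blockDet p * (productOver (Δ a w) (bendsFrom (suc k) n) * _)
      ≈⟨ *-assoc _ _ _ ⟨
    blockDet p * productOver (Δ a w) (bendsFrom (suc k) n) * _ ∎
    where
    L = letter w (suc k)
    p = P w (suc k)

  det₂-pullTo : ∀ {r s} → r ≤ s → ∀ y z → orientation (letter w r) * det₂ (pullTo r s y) (pullTo r s z)
    ≈ productOver (Δ a w) (bends w r s) * (orientation (letter w s) * det₂ y z)
  det₂-pullTo {r} {s} r≤s y z = trans (det₂-pullRun r (s ∸ r) y z) (reflexive (≡.cong₂
    (λ ks k → productOver (Δ a w) ks * (orientation (letter w k) * det₂ y z))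
    (≡.sym (bends-iterate r s)) (ℕₚ.m+[n∸m]≡n r≤s)))

  Δ-at-bend : ℕ → Carrier
  Δ-at-bend k = if bend k then Δ a w k else 1#

  -- The factors of F(a,b) belonging to one side: `q < p` are the sorted left indices, `s < t` the
  -- sorted right ones, and the Boolean tells whether the corner variable replaces a Δ.
  leftValue rightValue : ℕ → ℕ → Bool → Carrier
  leftValue q p b = (if b then A a 1 1 else Δ a w q) * Δ-at-bend p
  rightValue s t b = (if b then A a (pp w) (qq w) else Δ a w (suc t)) * Δ-at-bend (suc s)

  -- The determinant of the two left functionals after transport to `p`. The vectors `y` and `z` are
  -- arbitrary, so that whatever arrives from the right end can be inserted.
  LeftFormula : ℕ → ℕ → Bool → Set _
  LeftFormula q p b = ∀ y z →
    ω (source p) y * ω (source q) (pullTo q p z) - ω (source p) z * ω (source q) (pullTo q p y)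
      ≈ leftValue q p b * det₂ y z

  RightFormula : ℕ → ℕ → Bool → Set _
  RightFormula s t b = det₂ (pullTo s t (target t)) (target s) ≈ rightValue s t b

  Δ-at-bend-straight : ∀ L {k} → letter w k ≡ L → letter w (suc k) ≡ L → Δ-at-bend (suc k) ≡ 1#
  Δ-at-bend-straight L eq₁ eq₂ rewrite bend-false L eq₁ eq₂ = ≡.refl

  Δ-at-bend-bent : ∀ L {k} → letter w k ≡ other L → letter w (suc k) ≡ L → Δ-at-bend (suc k) ≡ Δ a w (suc k)
  Δ-at-bend-bent L eq₁ eq₂ rewrite bend-true L eq₁ eq₂ = ≡.refl

  P-suc-letter : ∀ {L k} → 1 ≤ k → letter w k ≡ L → P w (suc k) ≡ step L (P w k)
  P-suc-letter 1≤k eq = ≡.trans (P-suc 1≤k) (≡.cong (λ L → step L _) eq)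

  left-adjacent : ∀ L q → 1 ≤ q → letter w q ≡ L → letter w (suc q) ≡ L → LeftFormula q (suc q) false
  left-adjacent L q 1≤q eq₁ eq₂ y z
    rewrite pullTo-suc q y | pullTo-suc q z | turn-straight L y eq₁ eq₂ | turn-straight L z eq₁ eq₂
          | Δ-at-bend-straight L eq₁ eq₂ | P-suc-letter 1≤q eq₁ | eq₁ | eq₂ | lo-step L (P w q) =
    trans (ω-hi-lo L (P w q) y z) (*-congʳ (sym (*-identityʳ _)))

  left-first : ∀ L k → 1 ≤ k → (∀ i → 1 ≤ i → i ≤ k → letter w i ≡ other L) → letter w (suc k) ≡ L →
    LeftFormula 1 (suc k) true
  left-first L k 1≤k before here y z = trans
    (reflexive (≡.cong₂ (λ y′ z′ → ω (source (suc k)) y * ω (source 1) z′ - ω (source (suc k)) z * ω (source 1) y′)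
      (pulled y) (pulled z)))
    (trans (core (letter w 1) (before 1 ℕₚ.≤-refl 1≤k))
      (*-congʳ (*-congˡ (reflexive (≡.sym (Δ-at-bend-bent L (before k 1≤k ℕₚ.≤-refl) here))))))
    where
    pulled : ∀ y → pullTo 1 (suc k) y ≡ transfer L (P w (suc k)) y
    pulled y = pullTo-bend-last L y 1≤k before here
    core : ∀ M → M ≡ other L →
      ω (source (suc k)) y * ω (lo M (1 , 1)) (transfer L (P w (suc k)) z)
        - ω (source (suc k)) z * ω (lo M (1 , 1)) (transfer L (P w (suc k)) y)
      ≈ A a 1 1 * blockDet (P w (suc k)) * det₂ y z
    -- For either letter the first entry of `lo` at (1,1) is a₁₁; it takes the place of `t`.
    core N M≡ rewrite here = ω-lo-combination L (P w (suc k)) _ (A a 1 1) y z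
    core E M≡ rewrite here = ω-lo-combination L (P w (suc k)) _ (A a 1 1) y z

  -- There are bends at `q + 1` and `k + 1`. Passing the first turns `source q` into a combination
  -- whose `hi` coefficient is -Δ_q; the block at the second contributes its own determinant.
  left-gap : ∀ L q k → 1 ≤ q → suc q ≤ k → letter w q ≡ L → (∀ i → q < i → i ≤ k → letter w i ≡ other L) →
    letter w (suc k) ≡ L → LeftFormula q (suc k) false
  left-gap L q k 1≤q q<k eq₁ between eq₂ y z = trans
    (reflexive (≡.cong₂ (λ y′ z′ → ω (source (suc k)) y * ω (source q) z′ - ω (source (suc k)) z * ω (source q) y′)
      (pulled y) (pulled z)))
    (trans (+-cong (*-cong (starts y) (startq z)) (-‿cong (*-cong (starts z) (startq y))))
      (trans (ω-lo-combination L (P w (suc k)) _ _ y z)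
        (*-congʳ (*-congˡ (reflexive (≡.sym (Δ-at-bend-bent L (between k q<k ℕₚ.≤-refl) eq₂)))))))
    where
    pulled : ∀ y → pullTo q (suc k) y ≡ transfer (other L) (P w (suc q)) (transfer L (P w (suc k)) y)
    pulled y = pullTo-gap L y q<k eq₁ between eq₂
    starts : ∀ y → ω (source (suc k)) y ≈ ω (lo L (P w (suc k))) y
    starts y = reflexive (≡.cong (λ M → ω (lo M (P w (suc k))) y) eq₂)
    startq : ∀ y → ω (source q) (transfer (other L) (P w (suc q)) (transfer L (P w (suc k)) y))
      ≈ turning-coefficient L (P w q) * ω (lo L (P w (suc k))) y - blockDet (P w q) * ω (hi L (P w (suc k))) y
    startq y = trans
      (reflexive (≡.cong₂ (λ M p → ω (lo M (P w q)) (transfer (other L) p (transfer L (P w (suc k)) y)))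
        eq₁ (P-suc-letter 1≤q eq₁)))
      (ω-lo-transfer L (P w q) (transfer L (P w (suc k)) y))

  left-Next : ∀ {L q p} → Next L q p → LeftFormula q p false
  left-Next {L} {q} {suc k} (next 1≤q (s≤s q≤k) _ eq₁ eq₂ between) with ℕₚ.m≤n⇒m<n∨m≡n q≤k
  ... | inj₁ q<k = left-gap L q k 1≤q q<k eq₁ (λ i q<i i≤k → between i q<i (s≤s i≤k)) eq₂
  ... | inj₂ ≡.refl = left-adjacent L q 1≤q eq₁ eq₂

  right-adjacent : ∀ L s → 1 ≤ s → letter w s ≡ L → letter w (suc s) ≡ L → RightFormula s (suc s) false
  right-adjacent L s 1≤s eq₁ eq₂
    rewrite pullTo-suc s (target (suc s)) | turn-straight L (target (suc s)) eq₁ eq₂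
          | Δ-at-bend-straight L eq₁ eq₂ | eq₁ | eq₂ | ≡.sym (lo-step L (P w (suc s))) =
    trans (det₂-hi-lo L (step L (P w (suc s)))) (sym (*-identityʳ _))

  right-last : ∀ L s t → 1 ≤ s → suc s ≤ t → letter w s ≡ L → (∀ i → s < i → i ≤ t → letter w i ≡ other L) →
    t ≡ l → RightFormula s t true
  right-last L s t 1≤s s<t eq after t≡l = trans
    (reflexive (≡.cong₂ det₂ pulled (≡.cong (λ M → hi M (P w (suc s))) eq)))
    (trans (det₂-transfer-hi L (P w (suc s)) _)
      (*-cong (reflexive corner) (reflexive (≡.sym
        (Δ-at-bend-bent (other L) (≡.trans eq (≡.sym (other-involutive L))) (after (suc s) ℕₚ.≤-refl s<t))))))
    where
    pulled : pullTo s t (target t) ≡ transfer (other L) (P w (suc s)) (target t)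
    pulled = pullTo-bend-first L (target t) s<t eq after
    hi₂ : ∀ M p → proj₂ (hi M p) ≡ A a (suc (proj₁ p)) (suc (proj₂ p))
    hi₂ N p = ≡.refl
    hi₂ E p = ≡.refl
    corner : proj₂ (target t) ≡ A a (pp w) (qq w)
    corner = ≡.trans (hi₂ (letter w t) (P w (suc t)))
      (≡.cong (λ p → A a (suc (proj₁ p)) (suc (proj₂ p))) (≡.trans (≡.cong (λ k → P w (suc k)) t≡l) P-end))

  -- The bend at `s + 1` contributes its block determinant times the second component of what
  -- arrives from the bend at `k + 1`. That component pairs two consecutive parallel edges, hence is
  -- the next Δ.
  right-gap : ∀ L s k → 1 ≤ s → suc s ≤ k → letter w s ≡ L → (∀ i → s < i → i ≤ k → letter w i ≡ other L) →
    letter w (suc k) ≡ L → RightFormula s (suc k) false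
  right-gap L s k 1≤s s<k eq₁ between eq₂ = trans
    (reflexive (≡.cong₂ det₂ pulled (≡.cong (λ M → hi M (P w (suc s))) eq₁)))
    (trans (det₂-transfer-hi L (P w (suc s)) _)
      (*-cong (trans second (reflexive (≡.cong blockDet (≡.sym P≡)))) (reflexive (≡.sym
        (Δ-at-bend-bent (other L) (≡.trans eq₁ (≡.sym (other-involutive L))) (between (suc s) ℕₚ.≤-refl s<k))))))
    where
    P≡ : P w (suc (suc k)) ≡ step L (P w (suc k))
    P≡ = P-suc-letter (s≤s z≤n) eq₂
    pulled : pullTo s (suc k) (target (suc k)) ≡ transfer (other L) (P w (suc s)) (transfer L (P w (suc k)) (target (suc k)))
    pulled = pullTo-gap L (target (suc k)) s<k eq₁ between eq₂
    second : ω (hi L (P w (suc k))) (target (suc k)) ≈ blockDet (step L (P w (suc k)))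
    second = trans (reflexive (≡.cong₂ (λ M p → ω (hi L (P w (suc k))) (hi M p)) eq₂ P≡)) (ω-hi-hi L (P w (suc k)))

  right-Next : ∀ {L s t} → Next L s t → RightFormula s t false
  right-Next {L} {s} {suc k} (next 1≤s (s≤s s≤k) _ eq₁ eq₂ between) with ℕₚ.m≤n⇒m<n∨m≡n s≤k
  ... | inj₁ s<k = right-gap L s k 1≤s s<k eq₁ (λ i s<i i≤k → between i s<i (s≤s i≤k)) eq₂
  ... | inj₂ ≡.refl = right-adjacent L s 1≤s eq₁ eq₂

-- The 2 × 2 minor and its comparison with F(a,b).

module Assembly {c ℓ} (R : CommutativeRing c ℓ) (a : ℤ → ℤ → CommutativeRing.Carrier R) (w : List Letter) where
  open CommutativeRing R hiding (zero)
  open WithRing R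
  open IntegerCoefficients R using (solve; _:=_; con; _:+_; _:*_; :-_; _:-_)
  open Staircases R a
  open Words w
  open Pulling R a w
  open import Relation.Binary.Reasoning.Setoid setoid

  record Left (q p : ℕ) (b : Bool) : Set (c Level.⊔ ℓ) where
    constructor left
    field
      positive : 1 ≤ q
      ordered : q < p
      bounded : p ≤ l
      corner : b ≡ true → q ≡ 1
      formula : LeftFormula q p b

  record Right (s t : ℕ) (b : Bool) : Set (c Level.⊔ ℓ) where
    constructor right
    field
      ordered : s < t
      bounded : t ≤ l
      corner : b ≡ true → t ≡ l
      formula : RightFormula s t b

  -- The letter kept is that of the inner index, an end of μ′; with the direction of the listing it
  -- settles the sign in `adjacent-minor`.
  data RowView (x y : ℕ) : Bool → Set (c Level.⊔ ℓ) where
    up : ∀ {b} → Left x y b → letter w y ≡ N → RowView x y b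
    down : ∀ {b} → Left y x b → letter w x ≡ E → RowView x y b

  data ColumnView (u v : ℕ) : Bool → Set (c Level.⊔ ℓ) where
    up : ∀ {b} → Right u v b → letter w u ≡ E → ColumnView u v b
    down : ∀ {b} → Right v u b → letter w v ≡ N → ColumnView u v b

  -- Index 1 carries one of the two letters, so it is the smaller of the two first occurrences.
  First-pair : ∀ L {q p} → First (other L) 1 l q → First L 1 l p → q < p → Left q p true
  First-pair L {q} {suc k} (first 1≤q _ q≡ beforeq) (first _ p≤ p≡ before) (s≤s q≤k) with ℕₚ.m≤n⇒m<n∨m≡n 1≤q
  ... | inj₁ 1<q = ⊥-elim (L≢other
    (≡.trans (≡.sym (before 1 ℕₚ.≤-refl (s≤s (ℕₚ.≤-trans 1≤q q≤k)))) (beforeq 1 ℕₚ.≤-refl 1<q)))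
  ... | inj₂ ≡.refl = left ℕₚ.≤-refl (s≤s q≤k) (ℕₚ.≤-pred p≤) (λ _ → ≡.refl)
    (left-first L k q≤k (λ i 1≤i i≤k → before i 1≤i (s≤s i≤k)) p≡)

  -- Likewise index `l` is the larger of the two last occurrences.
  Last-pair : ∀ L {s t} → Last L 1 l s → Last (other L) 1 l t → s < t → Right s t true
  Last-pair L {s} {t} (final 1≤s _ s≡ after) (final _ t≤ t≡ aftert) s<t with ℕₚ.m≤n⇒m<n∨m≡n (ℕₚ.≤-pred t≤)
  ... | inj₁ t<l = ⊥-elim (L≢other
    (≡.trans (≡.sym (after l (ℕₚ.<-trans s<t t<l) ℕₚ.≤-refl)) (aftert l t<l ℕₚ.≤-refl)))
  ... | inj₂ t≡l = right s<t (ℕₚ.≤-pred t≤) (λ _ → t≡l)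
    (right-last L s t 1≤s s<t s≡ (λ i s<i i≤t → after i s<i (ℕₚ.≤-trans (s≤s i≤t) t≤)) t≡l)

  left-of-Next : ∀ {L q p} → Next L q p → Left q p false
  left-of-Next n@(next 1≤q q<p p≤l _ _ _) = left 1≤q q<p p≤l (λ ()) (left-Next n)

  right-of-Next : ∀ {L s t} → Next L s t → Right s t false
  right-of-Next n@(next _ s<t t≤l _ _ _) = right s<t t≤l (λ ()) (right-Next n)

  rowView : ∀ {x y} → RowAdjacent x y → RowView x y (isE (letter w x) ∧ isN (letter w y))
  rowView (east n@(next _ _ _ y≡E x≡E _)) rewrite y≡E | x≡E = down (left-of-Next n) x≡E
  rowView (north n@(next _ _ _ x≡N y≡N _)) rewrite x≡N = up (left-of-Next n) y≡N
  rowView {x} {y} (turning fE@(first _ _ x≡E _) fN@(first _ _ y≡N _)) rewrite x≡E | y≡N with ℕₚ.<-cmp x y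
  ... | tri< x<y _ _ = up (First-pair N fE fN x<y) y≡N
  ... | tri≈ _ ≡.refl _ = ⊥-elim (L≢other (≡.trans (≡.sym x≡E) y≡N))
  ... | tri> _ _ y<x = down (First-pair E fN fE y<x) x≡E

  columnView : ∀ {u v} → ColumnAdjacent u v → ColumnView u v (isE (letter w u) ∧ isN (letter w v))
  columnView (east n@(next _ _ _ u≡E v≡E _)) rewrite u≡E | v≡E = up (right-of-Next n) u≡E
  columnView (north n@(next _ _ _ v≡N u≡N _)) rewrite u≡N = down (right-of-Next n) v≡N
  columnView {u} {v} (turning lE@(final _ _ u≡E _) lN@(final _ _ v≡N _)) rewrite u≡E | v≡N with ℕₚ.<-cmp u v
  ... | tri< u<v _ _ = up (Last-pair E lE lN u<v) u≡E
  ... | tri≈ _ ≡.refl _ = ⊥-elim (L≢other (≡.trans (≡.sym u≡E) v≡N))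
  ... | tri> _ _ v<u = down (Last-pair N lN lE v<u) v≡N

  orientation-square : ∀ L → orientation L * orientation L ≈ 1#
  orientation-square N = *-identityˡ 1#
  orientation-square E = solve 0 (:- con (+ 1) :* :- con (+ 1) := con (+ 1)) refl

  -- After transport to `p` the four values pair two functionals with the two vectors `U` and `V`,
  -- so the difference is a product of two determinants. The orientations on the left absorb the
  -- sign collected over the bends of μ′.
  cross-difference : ∀ {q p s t b b′} → Left q p b → Right s t b′ → p ≤ s →
    orientation (letter w p) * orientation (letter w s)
      * (cc a w p t * cc a w q s - cc a w p s * cc a w q t)
    ≈ leftValue q p b * productOver (Δ a w) (bends w p s) * rightValue s t b′
  cross-difference {q} {p} {s} {t} {b} {b′} (left _ q<p _ _ leftFormula) (right s<t _ _ rightFormula) p≤s = begin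
    o * o′ * (cc a w p t * cc a w q s - cc a w p s * cc a w q t)
      ≈⟨ *-congˡ (+-cong (*-cong c-pt c-qs) (-‿cong (*-cong c-ps c-qt))) ⟩
    o * o′ * (ω (source p) U * ω (source q) (pullTo q p V) - ω (source p) V * ω (source q) (pullTo q p U))
      ≈⟨ *-congˡ (leftFormula U V) ⟩
    o * o′ * (leftValue q p b * det₂ U V)
      ≈⟨ solve 4 (λ o o′ L d → o :* o′ :* (L :* d) := L :* o′ :* (o :* d)) refl o o′ _ _ ⟩
    leftValue q p b * o′ * (o * det₂ U V)
      ≈⟨ *-congˡ (trans (det₂-pullTo p≤s _ _) (*-congˡ (*-congˡ rightFormula))) ⟩
    leftValue q p b * o′ * (productOver (Δ a w) (bends w p s) * (o′ * rightValue s t b′))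
      ≈⟨ solve 4 (λ L o′ Π r → L :* o′ :* (Π :* (o′ :* r)) := (o′ :* o′) :* (L :* Π :* r)) refl _ o′ _ _ ⟩
    o′ * o′ * (leftValue q p b * productOver (Δ a w) (bends w p s) * rightValue s t b′)
      ≈⟨ trans (*-congʳ (orientation-square (letter w s))) (*-identityˡ _) ⟩
    leftValue q p b * productOver (Δ a w) (bends w p s) * rightValue s t b′ ∎
    where
    o = orientation (letter w p)
    o′ = orientation (letter w s)
    U = pullTo p s (pullTo s t (target t))
    V = pullTo p s (target s)
    q≤p = ℕₚ.<⇒≤ q<p
    s≤t = ℕₚ.<⇒≤ s<t
    c-pt : cc a w p t ≈ ω (source p) U
    c-pt = trans (cc-pullTo (ℕₚ.≤-trans p≤s s≤t))
      (reflexive (≡.cong (ω (source p)) (pullTo-trans p≤s s≤t (target t))))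
    c-ps : cc a w p s ≈ ω (source p) V
    c-ps = cc-pullTo p≤s
    c-qs : cc a w q s ≈ ω (source q) (pullTo q p V)
    c-qs = trans (cc-pullTo (ℕₚ.≤-trans q≤p p≤s))
      (reflexive (≡.cong (ω (source q)) (pullTo-trans q≤p p≤s (target s))))
    c-qt : cc a w q t ≈ ω (source q) (pullTo q p U)
    c-qt = trans (cc-pullTo (ℕₚ.≤-trans q≤p (ℕₚ.≤-trans p≤s s≤t)))
      (reflexive (≡.cong (ω (source q)) (≡.trans (pullTo-trans q≤p (ℕₚ.≤-trans p≤s s≤t) (target t))
        (≡.cong (pullTo q p) (pullTo-trans p≤s s≤t (target t))))))

  excluding : Bool → ℕ → List ℕ → List ℕ
  excluding b j ks = if b then filterᵇ (λ k → not (k ≡ᵇ j)) ks else ks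

  indices : ℕ → ℕ → ℕ → ℕ → List ℕ
  indices q p s t = bends w p s ++ endpoints q t ++ filterᵇ (λ k → elemᵇ k (bends w q t)) (endpoints p s)

  -- At the sorted indices this unfolds to `prodF`.
  product : ℕ → ℕ → ℕ → ℕ → Bool → Bool → Carrier
  product q p s t b b′ = productOver (Δ a w) (excluding b 1 (excluding b′ (suc l) (indices q p s t)))
    * (if b′ then A a (pp w) (qq w) else 1#) * (if b then A a 1 1 else 1#)

  productOver-filter : ∀ f g ks →
    productOver g (filterᵇ f ks) ≈ productOver (λ k → if f k then g k else 1#) ks
  productOver-filter f g [] = refl
  productOver-filter f g (k ∷ ks) with f k
  ... | true = *-congˡ (productOver-filter f g ks)
  ... | false = trans (productOver-filter f g ks) (sym (*-identityˡ _))

  productOver-cong : ∀ {f g} ks → (∀ k → f k ≈ g k) → productOver f ks ≈ productOver g ks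
  productOver-cong [] f≈g = refl
  productOver-cong (k ∷ ks) f≈g = *-cong (f≈g k) (productOver-cong ks f≈g)

  productOver-++ : ∀ g ks js → productOver g (ks ++ js) ≈ productOver g ks * productOver g js
  productOver-++ g [] js = sym (*-identityˡ _)
  productOver-++ g (k ∷ ks) js = trans (*-congˡ (productOver-++ g ks js)) (sym (*-assoc _ _ _))

  -- Removing an index amounts to replacing its factor by `1#`, which can be checked factor by
  -- factor.
  guard : Bool → ℕ → (ℕ → Carrier) → ℕ → Carrier
  guard b j g k = if b ∧ (k ≡ᵇ j) then 1# else g k

  productOver-excluding : ∀ b j g ks → productOver g (excluding b j ks) ≈ productOver (guard b j g) ks
  productOver-excluding false j g ks = refl
  productOver-excluding true j g ks = trans (productOver-filter _ g ks) (productOver-cong ks agree)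
    where
    agree : ∀ k → (if not (k ≡ᵇ j) then g k else 1#) ≈ guard true j g k
    agree k with k ≡ᵇ j
    ... | true = refl
    ... | false = refl

  guard-≢ : ∀ b j g {k} → k ≢ j → guard b j g k ≡ g k
  guard-≢ true j g k≢j rewrite ≡ᵇ-≢ k≢j = ≡.refl
  guard-≢ false j g k≢j = ≡.refl

  guard-≡ : ∀ j g → guard true j g j ≡ 1#
  guard-≡ j g rewrite ≡ᵇ-refl j = ≡.refl

  guard-1# : ∀ b j g {k} → g k ≡ 1# → guard b j g k ≡ 1#
  guard-1# b j g {k} eq with b ∧ (k ≡ᵇ j)
  ... | true = ≡.refl
  ... | false = eq

  productOver-bends : ∀ {f g} r n → (∀ k → r < k → k ≤ r ℕ.+ n → f k ≡ g k) →
    productOver f (bendsFrom r n) ≡ productOver g (bendsFrom r n)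
  productOver-bends r zero f≡g = ≡.refl
  productOver-bends r (suc n) f≡g with bend (suc r)
  ... | true = ≡.cong₂ _*_ (f≡g (suc r) ℕₚ.≤-refl (ℕₚ.m<m+n r (s≤s z≤n)))
    (productOver-bends (suc r) n (λ k r<k k≤ → f≡g k (ℕₚ.<⇒≤ r<k) (≡.subst (k ≤_) (≡.sym (ℕₚ.+-suc r n)) k≤)))
  ... | false = productOver-bends (suc r) n
    (λ k r<k k≤ → f≡g k (ℕₚ.<⇒≤ r<k) (≡.subst (k ≤_) (≡.sym (ℕₚ.+-suc r n)) k≤))

  -- The bends of μ′, as well as `p` and `s + 1`, lie strictly between 1 and `l + 1`. Hence the
  -- removals can affect only the endpoints `q` and `t + 1` of μ″, and they do so exactly when a
  -- corner variable is inserted.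
  product-value : ∀ {q p s t b b′} → Left q p b → Right s t b′ → p ≤ s →
    product q p s t b b′ ≈ leftValue q p b * productOver (Δ a w) (bends w p s) * rightValue s t b′
  product-value {q} {p} {s} {t} {b} {b′} (left 1≤q q<p p≤l corner _) (right s<t t≤l corner′ _) p≤s = begin
    product q p s t b b′
      ≈⟨ *-congʳ (*-congʳ (trans (productOver-excluding b 1 (Δ a w) _)
           (productOver-excluding b′ (suc l) (guard b 1 (Δ a w)) _))) ⟩
    productOver g (indices q p s t) * iR * iL
      ≈⟨ *-congʳ (*-congʳ (trans (productOver-++ g (bends w p s) _)
           (*-cong (reflexive bends≡) (*-congˡ (*-congˡ (trans (productOver-filter (λ k → elemᵇ k (bends w q t)) g (endpoints p s))
             (reflexive (≡.cong₂ (λ x y → x * (y * 1#)) p≡ s≡)))))))) ⟩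
    Π * (g q * (g (suc t) * (Δ-at-bend p * (Δ-at-bend (suc s) * 1#)))) * iR * iL
      ≈⟨ solve 7 (λ Π gq gt x y iR iL → Π :* (gq :* (gt :* (x :* (y :* con (+ 1))))) :* iR :* iL
           := gq :* iL :* x :* Π :* (gt :* iR :* y)) refl Π (g q) (g (suc t)) (Δ-at-bend p) (Δ-at-bend (suc s)) iR iL ⟩
    g q * iL * Δ-at-bend p * Π * (g (suc t) * iR * Δ-at-bend (suc s))
      ≈⟨ *-cong (*-congʳ (*-congʳ (left-factor b corner))) (*-congʳ (right-factor b′ corner′)) ⟩
    leftValue q p b * Π * rightValue s t b′ ∎
    where
    g = guard b′ (suc l) (guard b 1 (Δ a w))
    iR = if b′ then A a (pp w) (qq w) else 1#
    iL = if b then A a 1 1 else 1#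
    Π = productOver (Δ a w) (bends w p s)
    1<p = ℕₚ.≤-<-trans 1≤q q<p
    inner : ∀ {k} → 1 < k → k ≤ l → g k ≡ Δ a w k
    inner 1<k k≤l = ≡.trans (guard-≢ b′ (suc l) (guard b 1 (Δ a w)) (ℕₚ.<⇒≢ (s≤s k≤l))) (guard-≢ b 1 (Δ a w) (ℕₚ.>⇒≢ 1<k))
    bends≡ : productOver g (bends w p s) ≡ Π
    bends≡ rewrite bends-iterate p s = productOver-bends p (s ∸ p) (λ k p<k k≤ →
      inner (ℕₚ.<-trans 1<p p<k)
        (ℕₚ.≤-trans (≡.subst (k ≤_) (ℕₚ.m+[n∸m]≡n p≤s) k≤) (ℕₚ.≤-trans (ℕₚ.<⇒≤ s<t) t≤l)))
    at-bend : ∀ {k} → q < k → k ≤ t → 1 < k → (if elemᵇ k (bends w q t) then g k else 1#) ≡ Δ-at-bend k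
    at-bend q<k k≤t 1<k = ≡.cong₂ (λ β x → if β then x else 1#)
      (elemᵇ-bends q<k k≤t) (inner 1<k (ℕₚ.≤-trans k≤t t≤l))
    p≡ : (if elemᵇ p (bends w q t) then g p else 1#) ≡ Δ-at-bend p
    p≡ = at-bend q<p (ℕₚ.≤-trans p≤s (ℕₚ.<⇒≤ s<t)) 1<p
    s≡ : (if elemᵇ (suc s) (bends w q t) then g (suc s) else 1#) ≡ Δ-at-bend (suc s)
    s≡ = at-bend (ℕₚ.m<n⇒m<1+n (ℕₚ.<-≤-trans q<p p≤s)) s<t (s≤s (ℕₚ.≤-trans (ℕₚ.<⇒≤ 1<p) p≤s))
    left-factor : ∀ b → (b ≡ true → q ≡ 1) →
      guard b′ (suc l) (guard b 1 (Δ a w)) q * (if b then A a 1 1 else 1#) ≈ (if b then A a 1 1 else Δ a w q)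
    left-factor true corner rewrite corner ≡.refl =
      trans (*-congʳ (reflexive (guard-1# b′ (suc l) (guard true 1 (Δ a w)) {1} ≡.refl))) (*-identityˡ _)
    left-factor false corner = trans (*-identityʳ _)
      (reflexive (guard-≢ b′ (suc l) (Δ a w) (ℕₚ.<⇒≢ (s≤s (ℕₚ.≤-trans (ℕₚ.<⇒≤ q<p) p≤l)))))
    right-factor : ∀ b′ → (b′ ≡ true → t ≡ l) →
      guard b′ (suc l) (guard b 1 (Δ a w)) (suc t) * (if b′ then A a (pp w) (qq w) else 1#)
        ≈ (if b′ then A a (pp w) (qq w) else Δ a w (suc t))
    right-factor true corner′ = trans
      (*-congʳ (reflexive (≡.trans (≡.cong (λ k → guard true (suc l) (guard b 1 (Δ a w)) (suc k)) (corner′ ≡.refl))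
        (guard-≡ (suc l) (guard b 1 (Δ a w)))))) (*-identityˡ _)
    right-factor false corner′ = trans (*-identityʳ _)
      (reflexive (guard-≢ b 1 (Δ a w) (ℕₚ.>⇒≢ (s≤s (ℕₚ.≤-trans (s≤s z≤n) s<t)))))

  -- If ρ ascends, the inner left index carries N and has orientation 1; if it descends, E and -1.
  -- For κ, ascending gives -1 and descending 1. The product of the two orientations is therefore
  -- the sign relating this difference to the sorted one in `cross-difference`.
  adjacent-minor : ∀ {x y u v b b′} → RowView x y b → ColumnView u v b′ → x ≤ u → x ≤ v → y ≤ u → y ≤ v →
    cc a w y u * cc a w x v - cc a w y v * cc a w x u ≈ product (x ⊓ y) (x ⊔ y) (u ⊓ v) (u ⊔ v) b b′
  adjacent-minor (up L y≡) (up M u≡) x≤u x≤v y≤u y≤v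
    rewrite ℕₚ.m≤n⇒m⊓n≡m (ℕₚ.<⇒≤ (Left.ordered L)) | ℕₚ.m≤n⇒m⊔n≡n (ℕₚ.<⇒≤ (Left.ordered L))
          | ℕₚ.m≤n⇒m⊓n≡m (ℕₚ.<⇒≤ (Right.ordered M)) | ℕₚ.m≤n⇒m⊔n≡n (ℕₚ.<⇒≤ (Right.ordered M)) = begin
    _ ≈⟨ solve 4 (λ α β γ δ → α :* β :- γ :* δ := con (+ 1) :* :- con (+ 1) :* (γ :* δ :- α :* β)) refl _ _ _ _ ⟩
    1# * - 1# * _ ≈⟨ *-congʳ (*-cong (reflexive (≡.cong orientation y≡)) (reflexive (≡.cong orientation u≡))) ⟨
    _ ≈⟨ cross-difference L M y≤u ⟩
    _ ≈⟨ product-value L M y≤u ⟨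
    _ ∎
  adjacent-minor (up L y≡) (down M v≡) x≤u x≤v y≤u y≤v
    rewrite ℕₚ.m≤n⇒m⊓n≡m (ℕₚ.<⇒≤ (Left.ordered L)) | ℕₚ.m≤n⇒m⊔n≡n (ℕₚ.<⇒≤ (Left.ordered L))
          | ℕₚ.m≥n⇒m⊓n≡n (ℕₚ.<⇒≤ (Right.ordered M)) | ℕₚ.m≥n⇒m⊔n≡m (ℕₚ.<⇒≤ (Right.ordered M)) = begin
    _ ≈⟨ solve 4 (λ α β γ δ → α :* β :- γ :* δ := con (+ 1) :* con (+ 1) :* (α :* β :- γ :* δ)) refl _ _ _ _ ⟩
    1# * 1# * _ ≈⟨ *-congʳ (*-cong (reflexive (≡.cong orientation y≡)) (reflexive (≡.cong orientation v≡))) ⟨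
    _ ≈⟨ cross-difference L M y≤v ⟩
    _ ≈⟨ product-value L M y≤v ⟨
    _ ∎
  adjacent-minor (down L x≡) (up M u≡) x≤u x≤v y≤u y≤v
    rewrite ℕₚ.m≥n⇒m⊓n≡n (ℕₚ.<⇒≤ (Left.ordered L)) | ℕₚ.m≥n⇒m⊔n≡m (ℕₚ.<⇒≤ (Left.ordered L))
          | ℕₚ.m≤n⇒m⊓n≡m (ℕₚ.<⇒≤ (Right.ordered M)) | ℕₚ.m≤n⇒m⊔n≡n (ℕₚ.<⇒≤ (Right.ordered M)) = begin
    _ ≈⟨ solve 4 (λ α β γ δ → α :* β :- γ :* δ := :- con (+ 1) :* :- con (+ 1) :* (β :* α :- δ :* γ)) refl _ _ _ _ ⟩
    - 1# * - 1# * _ ≈⟨ *-congʳ (*-cong (reflexive (≡.cong orientation x≡)) (reflexive (≡.cong orientation u≡))) ⟨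
    _ ≈⟨ cross-difference L M x≤u ⟩
    _ ≈⟨ product-value L M x≤u ⟨
    _ ∎
  adjacent-minor (down L x≡) (down M v≡) x≤u x≤v y≤u y≤v
    rewrite ℕₚ.m≥n⇒m⊓n≡n (ℕₚ.<⇒≤ (Left.ordered L)) | ℕₚ.m≥n⇒m⊔n≡m (ℕₚ.<⇒≤ (Left.ordered L))
          | ℕₚ.m≥n⇒m⊓n≡n (ℕₚ.<⇒≤ (Right.ordered M)) | ℕₚ.m≥n⇒m⊔n≡m (ℕₚ.<⇒≤ (Right.ordered M)) = begin
    _ ≈⟨ solve 4 (λ α β γ δ → α :* β :- γ :* δ := :- con (+ 1) :* con (+ 1) :* (δ :* γ :- β :* α)) refl _ _ _ _ ⟩
    - 1# * 1# * _ ≈⟨ *-congʳ (*-cong (reflexive (≡.cong orientation x≡)) (reflexive (≡.cong orientation v≡))) ⟨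
    _ ≈⟨ cross-difference L M x≤v ⟩
    _ ≈⟨ product-value L M x≤v ⟨
    _ ∎

theorem8p3 : ∀ {c ℓ} (R : CommutativeRing c ℓ) (a : ℤ → ℤ → CommutativeRing.Carrier R)
    (w : List Letter) → 1 ≤ length w → (i j : ℕ) → Quadruple w i j →
    let open CommutativeRing R
        open WithRing R
    in cc a w (ρ w (suc i)) (κ w j) * cc a w (ρ w i) (κ w (suc j))
       - cc a w (ρ w (suc i)) (κ w (suc j)) * cc a w (ρ w i) (κ w j)
       ≈ prodF a w i j
theorem8p3 R a w _ i j (1≤i , i≤ , 1≤j , j≤ , ρ≤κ , ρ≤κ′ , ρ′≤κ , ρ′≤κ′) =
  adjacent-minor (rowView (ρ-adjacent i 1≤i i≤)) (columnView (κ-adjacent j 1≤j j≤)) ρ≤κ ρ≤κ′ ρ′≤κ ρ′≤κ′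
  where
  open Words w using (ρ-adjacent; κ-adjacent)
  open Assembly R a w using (adjacent-minor; rowView; columnView)
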